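{- Let $n\ge 1$ and define $A_n^{(\mathsf{cyc}^*-\mathsf{fix}^*,\mathsf{exc})}(q,t)=\sum_{\sigma\in\mathfrak{S}_n}q^{(\mathsf{cyc}^*-\mathsf{fix}^*)\sigma}t^{\mathsf{exc}\,\sigma}$. Then $$A_{n}^{(\mathsf{cyc}^*-\mathsf{fix}^*, \mathsf{exc})}(q, t)=\left(\frac{1+xt}{1+x}\right)^{n-1}P^{(\mathsf{cyc}^*-\mathsf{fix}^*, \mathsf{cpk}^*,\mathsf{exc})}\left(\mathfrak{S}_n; q, \frac{(1+x)^{2}t}{(x+t)(1+xt)},\frac{x+t}{1+xt}\right),$$ equivalently, $$P^{(\mathsf{cyc}^*-\mathsf{fix}^*, \mathsf{cpk}^*,\mathsf{exc})}(\mathfrak{S}_n; q, x,t)=\left(\frac{1+u}{1+uv}\right)^{n-1}A_{n}^{(\mathsf{cyc}^*-\mathsf{fix}^*,\mathsf{exc})}(q, v),$$ where $u=\frac{1+t^{2}-2xt-(1-t)\sqrt{(1+t)^{2}-4xt}}{2(1-x)t}$ and $v=\frac{(1+t)^{2}-2xt-(1+t)\sqrt{(1+t)^{2}-4xt}}{2xt}$.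
   Context: $\mathfrak{S}_n$ is the set of permutations of $[n]$. $P^{(\mathsf{stat}_1,\ldots,\mathsf{stat}_m)}(\Omega;t_1,\ldots,t_m)=\sum_{\sigma\in\Omega}\prod_j t_j^{\mathsf{stat}_j\sigma}$. For $\sigma\in\mathfrak{S}_n$, $\mathsf{exc}\,\sigma=\#\{i:\sigma(i)>i\}$. The star companion $\sigma^*$ is the permutation of $\{0,\dots,n\}$ with $\sigma^*(0)=n$, $\sigma^*(i)=\sigma(i)-1$ for $i\in[n]$. $\mathsf{cyc}^*\sigma$ is the number of cycles of $\sigma^*$; $\mathsf{fix}^*\sigma=\#\{i\in[n-1]:\sigma^*(i)=i\}$; $\mathsf{cpk}^*\sigma=\#\{i\in[n-1]:(\sigma^*)^{ -1}(i)<i>\sigma^*(i)\}$. -}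

module Defs where

open import Algebra.Bundles using (CommutativeRing; Semiring)
import Algebra.Definitions as AlgebraDefinitions
import Algebra.Definitions.RawSemiring as RawSemiringDefinitions
open import Data.Fin using (Fin; zero; suc; toℕ; fromℕ; fromℕ<; inject₁; punchIn; _≟_)
import Data.Fin as Fin
open import Data.Fin.Permutation
  using (Permutation′; _⟨$⟩ʳ_; _⟨$⟩ˡ_; inverseˡ; id; insert; remove; insert-remove; insert-punchIn)
  renaming (_≈_ to _≈ₚ_)
open import Data.Fin.Properties
  using (any?; pigeonhole; toℕ-fromℕ<; toℕ<n; punchIn-injective)
open import Data.List
  using (List; []; _∷_; map; concatMap; foldr; filter; length; allFin; deduplicate)
open import Data.List.Membership.Propositional.Properties using (∈-allFin)
open import Data.List.Properties using (filter-accept; filter-reject; length-filter)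
open import Data.List.Relation.Unary.All as All using (All; []; _∷_)
import Data.List.Relation.Unary.All.Properties as All
open import Data.List.Relation.Unary.AllPairs as AllPairs using (AllPairs; []; _∷_)
import Data.List.Relation.Unary.AllPairs.Properties as AllPairs
open import Data.List.Relation.Unary.Any as Any using (Any; here)
import Data.List.Relation.Unary.Any.Properties as Any
open import Data.List.Relation.Unary.Unique.Propositional.Properties using (allFin⁺)
open import Data.Nat as ℕ using (ℕ; zero; suc; _∸_)
import Data.Nat.DivMod as ℕ
import Data.Nat.Properties as ℕ
open import Data.Product using (∃; ∃-syntax; _×_; _,_; proj₁)
open import Data.Vec as Vec using (Vec; zipWith)
open import Function using (_∘_)
import Function.Endo.Propositional as Endo
open import Level using (0ℓ; _⊔_)
open import Relation.Binary using (Rel; Decidable)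
open import Relation.Binary.PropositionalEquality
  using (_≡_; _≢_; refl; sym; trans; cong; cong-app; module ≡-Reasoning)
open import Relation.Nullary using (¬_; yes; no; contradiction)
open import Relation.Nullary.Decidable using (_×-dec_; ¬?)
import Relation.Nullary.Decidable as Dec
open import Relation.Unary using (Pred) renaming (Decidable to Decidable₁)

-- A permutation of [n] is a Permutation′ n, where i : Fin n stands for the
-- element toℕ i + 1 of [n].  The lemmas 𝔖-complete and 𝔖-distinct say that
-- this list contains every permutation exactly once.
𝔖 : ∀ n → List (Permutation′ n)
𝔖 zero    = id ∷ []
𝔖 (suc n) = concatMap (λ j → map (insert zero j) (𝔖 n)) (allFin (suc n))

𝔖-complete : ∀ {n} (π : Permutation′ n) → Any (π ≈ₚ_) (𝔖 n)
𝔖-complete {zero}  π = here λ ()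
𝔖-complete {suc n} π =
  Any.concatMap⁺ (λ j → map (insert zero j) (𝔖 n))
    (Any.map (λ { refl → Any.map⁺ (Any.map (λ {ρ} → step ρ) (𝔖-complete (remove zero π))) })
      (∈-allFin (π ⟨$⟩ʳ zero)))
  where
  step : ∀ ρ → remove zero π ≈ₚ ρ → π ≈ₚ insert zero (π ⟨$⟩ʳ zero) ρ
  step ρ eq zero    = refl
  step ρ eq (suc i) =
    trans (sym (insert-remove zero π (suc i))) (cong (punchIn (π ⟨$⟩ʳ zero)) (eq i))

𝔖-distinct : ∀ n → AllPairs (λ π ρ → ¬ (π ≈ₚ ρ)) (𝔖 n)
𝔖-distinct zero    = [] ∷ []
𝔖-distinct (suc n) = AllPairs.concat⁺
  (All.map⁺ (All.universal (λ j → AllPairs.map⁺ (AllPairs.map (sameHead j) (𝔖-distinct n))) _))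
  (AllPairs.map⁺ (AllPairs.map diffHead (allFin⁺ (suc n))))
  where
  sameHead : ∀ j {π ρ : Permutation′ n} → ¬ (π ≈ₚ ρ) → ¬ (insert zero j π ≈ₚ insert zero j ρ)
  sameHead j π≉ρ eq = π≉ρ λ i → punchIn-injective j _ _ (eq (suc i))

  diffHead : ∀ {j k} → j ≢ k →
    All (λ π → All (λ ρ → ¬ (π ≈ₚ ρ)) (map (insert zero k) (𝔖 n))) (map (insert zero j) (𝔖 n))
  diffHead j≢k = All.map⁺ (All.universal (λ _ →
    All.map⁺ (All.universal (λ _ eq → j≢k (eq zero)) _)) _)

#_ : ∀ {m} {P : Pred (Fin m) 0ℓ} → Decidable₁ P → ℕ
# P? = length (filter P? (allFin _))

exc : ∀ {n} → Permutation′ n → ℕ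
exc σ = # λ i → i Fin.<? (σ ⟨$⟩ʳ i)

module _ {m} (π : Permutation′ m) where

  open Endo (Fin m) using (_^_; ^-homo)

  SameCycle : Rel (Fin m) 0ℓ
  SameCycle i j = ∃[ k ] ((π ⟨$⟩ʳ_) ^ k) i ≡ j

  private
    infixr 9 _↑_
    _↑_ : ℕ → Fin m → Fin m
    k ↑ i = ((π ⟨$⟩ʳ_) ^ k) i

    ↑-+ : ∀ a b i → (a ℕ.+ b) ↑ i ≡ a ↑ b ↑ i
    ↑-+ a b i = cong-app (^-homo (π ⟨$⟩ʳ_) a b) i

    π-injective : ∀ {i j} → π ⟨$⟩ʳ i ≡ π ⟨$⟩ʳ j → i ≡ j
    π-injective eq = trans (sym (inverseˡ π)) (trans (cong (π ⟨$⟩ˡ_) eq) (inverseˡ π))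

    ↑-injective : ∀ k {i j} → k ↑ i ≡ k ↑ j → i ≡ j
    ↑-injective zero    eq = eq
    ↑-injective (suc k) eq = ↑-injective k (π-injective eq)

    period : ∀ i → ∃[ p ] p ℕ.< m × suc p ↑ i ≡ i
    period i with pigeonhole (ℕ.n<1+n m) (λ a → toℕ a ↑ i)
    ... | a , b , a<b , eq with ℕ.m≤n⇒∃[o]m+o≡n a<b
    ...   | d , a+1+d≡b = d , d<m , sym (↑-injective (toℕ a) eq′)
      where
      a+[1+d]≡b : toℕ a ℕ.+ suc d ≡ toℕ b
      a+[1+d]≡b = trans (ℕ.+-suc (toℕ a) d) a+1+d≡b

      d<m : d ℕ.< m
      d<m = ℕ.≤-trans (ℕ.m≤n+m (suc d) (toℕ a))
        (ℕ.≤-trans (ℕ.≤-reflexive a+[1+d]≡b) (ℕ.s≤s⁻¹ (toℕ<n b)))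

      eq′ : toℕ a ↑ i ≡ toℕ a ↑ suc d ↑ i
      eq′ = trans eq (trans (cong (_↑ i) (sym a+[1+d]≡b)) (↑-+ (toℕ a) (suc d) i))

    ↑-multiple : ∀ p i → p ↑ i ≡ i → ∀ q → (q ℕ.* p) ↑ i ≡ i
    ↑-multiple p i eq zero    = refl
    ↑-multiple p i eq (suc q) =
      trans (↑-+ p (q ℕ.* p) i) (trans (cong (p ↑_) (↑-multiple p i eq q)) eq)

    bounded : ∀ {i j} → SameCycle i j → ∃ λ (k : Fin m) → toℕ k ↑ i ≡ j
    bounded {i} {j} (k , k↑i≡j) with period i
    ... | p , p<m , eq = fromℕ< r<m , (begin
      toℕ (fromℕ< r<m) ↑ i         ≡⟨ cong (_↑ i) (toℕ-fromℕ< r<m) ⟩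
      r ↑ i                        ≡⟨ cong (r ↑_) (↑-multiple (suc p) i eq q) ⟨
      r ↑ (q ℕ.* suc p) ↑ i        ≡⟨ ↑-+ r (q ℕ.* suc p) i ⟨
      (r ℕ.+ q ℕ.* suc p) ↑ i      ≡⟨ cong (_↑ i) (ℕ.m≡m%n+[m/n]*n k (suc p)) ⟨
      k ↑ i                        ≡⟨ k↑i≡j ⟩
      j                            ∎)
      where
      open ≡-Reasoning
      r = k ℕ.% suc p
      q = k ℕ./ suc p
      r<m : r ℕ.< m
      r<m = ℕ.<-≤-trans (ℕ.m%n<n k (suc p)) p<m

  sameCycle? : Decidable SameCycle
  sameCycle? i j =
    Dec.map′ (λ (k , eq) → toℕ k , eq) bounded (any? λ k → (toℕ k ↑ i) ≟ j)

  -- One representative is kept from each class of SameCycle.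
  cyc : ℕ
  cyc = length (deduplicate sameCycle? (allFin m))

  sameCycle-fixed : ∀ {i j} → π ⟨$⟩ʳ j ≡ j → SameCycle i j → i ≡ j
  sameCycle-fixed {i} {j} fix (k , eq) = ↑-injective k (trans eq (sym (stays k)))
    where
    stays : ∀ k → k ↑ j ≡ j
    stays zero    = refl
    stays (suc k) = trans (cong (π ⟨$⟩ʳ_) (stays k)) fix

-- A permutation of {0,…,n} is a Permutation′ (suc n), where i : Fin (suc n)
-- stands for toℕ i itself.  Under the conventions above the element
-- suc i : Fin (suc n) is the element i : Fin n of [n], and subtracting one
-- from the element σ(i) of [n] amounts to inject₁.
infix 9 _⋆
_⋆ : ∀ {n} → Permutation′ n → Permutation′ (suc n)
_⋆ {n} σ = insert zero (fromℕ n) σ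

⋆-zero : ∀ {n} (σ : Permutation′ n) → σ ⋆ ⟨$⟩ʳ zero ≡ fromℕ n
⋆-zero σ = refl

⋆-suc : ∀ {n} (σ : Permutation′ n) i → σ ⋆ ⟨$⟩ʳ suc i ≡ inject₁ (σ ⟨$⟩ʳ i)
⋆-suc {n} σ i = trans (insert-punchIn zero (fromℕ n) σ i) (punchIn-fromℕ (σ ⟨$⟩ʳ i))
  where
  punchIn-fromℕ : ∀ {n} (j : Fin n) → punchIn (fromℕ n) j ≡ inject₁ j
  punchIn-fromℕ zero    = refl
  punchIn-fromℕ (suc j) = cong suc (punchIn-fromℕ j)

-- Membership in the subset [n-1] of {0,…,n}.
Inner : ∀ {n} → Pred (Fin (suc n)) 0ℓ
Inner {n} i = 0 ℕ.< toℕ i × toℕ i ℕ.< n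

inner? : ∀ {n} → Decidable₁ (Inner {n})
inner? {n} i = (0 ℕ.<? toℕ i) ×-dec (toℕ i ℕ.<? n)

cyc* : ∀ {n} → Permutation′ n → ℕ
cyc* σ = cyc (σ ⋆)

fix* : ∀ {n} → Permutation′ n → ℕ
fix* σ = # λ i → inner? i ×-dec ((σ ⋆ ⟨$⟩ʳ i) ≟ i)

cpk* : ∀ {n} → Permutation′ n → ℕ
cpk* σ = # λ i → inner? i ×-dec (((σ ⋆ ⟨$⟩ˡ i) Fin.<? i) ×-dec ((σ ⋆ ⟨$⟩ʳ i) Fin.<? i))

-- The truncated subtraction is a true one, by fix*≤cyc*.
cyc*-fix* : ∀ {n} → Permutation′ n → ℕ
cyc*-fix* σ = cyc* σ ∸ fix* σ

private
  module _ {A : Set} {F : Pred A 0ℓ} (F? : Decidable₁ F) where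

    filter-filter : ∀ {G : Pred A 0ℓ} (G? : Decidable₁ G) {xs} →
      All (λ x → F x → G x) xs → filter F? (filter G? xs) ≡ filter F? xs
    filter-filter G? [] = refl
    filter-filter G? {x ∷ xs} (F⇒G ∷ rest) with G? x
    ... | yes _ with F? x
    ...   | yes _ = cong (x ∷_) (filter-filter G? rest)
    ...   | no  _ = filter-filter G? rest
    filter-filter G? {x ∷ xs} (F⇒G ∷ rest) | no ¬g =
      trans (filter-filter G? rest) (sym (filter-reject F? (¬g ∘ F⇒G)))

    filter-deduplicate : ∀ {R : Rel A 0ℓ} (R? : Decidable R) {xs} →
      AllPairs (λ x y → F y → ¬ R x y) xs → filter F? (deduplicate R? xs) ≡ filter F? xs
    filter-deduplicate R? [] = refl
    filter-deduplicate R? {x ∷ xs} (px ∷ pxs) with F? x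
    ... | yes _ = cong (x ∷_) tails
      where
      tails = trans (filter-filter (¬? ∘ R? x) (All.deduplicate⁺ R? px)) (filter-deduplicate R? pxs)
    ... | no  _ =
      trans (filter-filter (¬? ∘ R? x) (All.deduplicate⁺ R? px)) (filter-deduplicate R? pxs)

fix*≤cyc* : ∀ {n} (σ : Permutation′ n) → fix* σ ℕ.≤ cyc* σ
fix*≤cyc* {n} σ = begin
  fix* σ                    ≡⟨ cong length (filter-deduplicate F? (sameCycle? (σ ⋆)) separate) ⟨
  length (filter F? cycles) ≤⟨ length-filter F? cycles ⟩
  cyc* σ                    ∎
  where
  open ℕ.≤-Reasoning
  cycles = deduplicate (sameCycle? (σ ⋆)) (allFin (suc n))
  F? = λ i → inner? i ×-dec ((σ ⋆ ⟨$⟩ʳ i) ≟ i)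
  separate : AllPairs (λ i j → Inner j × σ ⋆ ⟨$⟩ʳ j ≡ j → ¬ SameCycle (σ ⋆) i j) (allFin (suc n))
  separate = AllPairs.map (λ i≢j (_ , fix) same → i≢j (sameCycle-fixed (σ ⋆) fix same)) (allFin⁺ (suc n))

-- An identity of rational functions is read as an identity holding for all
-- elements of all commutative rings in which the denominators are units; the
-- original identity is the case of indeterminates in a suitable localisation.
module GeneratingFunctions {c ℓ} (R : CommutativeRing c ℓ) where

  open CommutativeRing R
  open RawSemiringDefinitions (Semiring.rawSemiring semiring) public
    using (_^_) renaming (_×_ to infixr 8 _·_)

  Unit : Carrier → Set (c ⊔ ℓ)
  Unit = AlgebraDefinitions.Invertible _≈_ 1# _*_

  _/_[_] : ∀ a b → Unit b → Carrier
  a / b [ b⁻¹ ] = a * proj₁ b⁻¹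

  ∑ : ∀ {S : Set} → List S → (S → Carrier) → Carrier
  ∑ Ω f = foldr _+_ 0# (map f Ω)

  P : ∀ {n m} → Vec (Permutation′ n → ℕ) m → List (Permutation′ n) → Vec Carrier m → Carrier
  P stats Ω ts = ∑ Ω λ σ → Vec.foldr′ _*_ 1# (zipWith (λ stat t → t ^ stat σ) stats ts)

  A : ℕ → Carrier → Carrier → Carrier
  A n q t = ∑ (𝔖 n) λ σ → q ^ cyc*-fix* σ * t ^ exc σ

{-# OPTIONS --safe #-}

-- Fixed points of σ⋆ in [n-1] behave like double ascents inserted into the
-- arc 0 → n, where no other element may be inserted.  To see this, build σ⋆ by
-- inserting new smallest elements (above 0) into arcs other than 0 → n, or as
-- fixed points, and record each σ⋆ by the letters of its inner elements.  One
-- insertion acts on functions of words by T; it adds a valley and acts as a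
-- derivation on the other letters, apart from the term descent + fixed.  The
-- span of the words in descent + fixed, descent + ascent, peak and valley is
-- stable under this, so in P the letters only occur through the two sums, both
-- of weight 1 + t, and through peaks paired with valleys, of weight x t.  Hence
-- P = q Γ (1 + t) (x t) with Γ s y homogeneous of degree n - 1 for s in degree
-- 1 and y in degree 2, and both identities are rescalings of Γ:
-- c (1 + t′) = 1 + t and c² x′ t′ = t in the first one, c (1 + v) = 1 + t and
-- c² v = x t in the second.

module Submission where

open import Algebra.Bundles using (CommutativeMonoid; CommutativeRing; RawRing)
import Algebra.Properties.AbelianGroup as AbelianGroupProperties
import Algebra.Properties.CommutativeMonoid.Sum as MonoidSum
import Algebra.Properties.CommutativeSemigroup as SemigroupProperties
import Algebra.Properties.Ring as RingProperties
import Algebra.Properties.Semiring.Exp as Exp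
import Algebra.Properties.Semiring.Mult as Mult
import Algebra.Properties.Semiring.Sum as SemiringSum
import Algebra.Solver.Ring as RingSolver
open import Algebra.Solver.Ring.AlmostCommutativeRing using (fromCommutativeRing; _-Raw-AlmostCommutative⟶_)
open import Data.Bool using (Bool; true; false; not; if_then_else_; _∧_)
open import Data.Bool.Properties using (∧-zeroʳ)
open import Data.Fin as Fin using (Fin; zero; suc; fromℕ; inject₁; punchIn; toℕ; _≟_)
open import Data.Fin.Permutation
  using (Permutation′; _⟨$⟩ʳ_; _⟨$⟩ˡ_; inverseˡ; inverseʳ; insert; insert-punchIn; insert-remove;
    punchIn-permute; remove; transpose; _∘ₚ_)
  renaming (_≈_ to _≈ₚ_)
import Data.Fin.Permutation as Perm
import Data.Fin.Permutation.Components as Components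
import Data.Fin.Properties as Fin
open import Data.Fin.Properties using (fromℕ≢inject₁; inject₁-injective; pigeonhole; punchIn-injective; punchInᵢ≢i)
open import Data.Fin.Relation.Unary.Top using (view; ‵fromℕ; ‵inject₁)
open import Data.List as List using (List; []; _∷_; _++_; allFin; concatMap; deduplicate; filter; length; map)
open import Data.List.Membership.Propositional.Properties using (∈-allFin)
import Data.List.Membership.Setoid as SetoidMembership
open import Data.List.Membership.Setoid.Properties using (∈-∃++)
open import Data.List.Properties using (length-map)
import Data.List.Relation.Binary.Permutation.Setoid as SetoidPermutation
import Data.List.Relation.Binary.Permutation.Setoid.Properties as Permutation
open import Data.List.Relation.Unary.All as All using (All)
import Data.List.Relation.Unary.All.Properties as All
open import Data.List.Relation.Unary.AllPairs as AllPairs using (AllPairs; []; _∷_)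
import Data.List.Relation.Unary.AllPairs.Properties as AllPairs
open import Data.List.Relation.Unary.Any as Any using (Any; here; there)
import Data.List.Relation.Unary.Any.Properties as Any
open import Data.List.Relation.Unary.Enumerates.Setoid using (IsEnumeration)
import Data.List.Relation.Unary.Enumerates.Setoid.Properties as Enumerates
import Data.List.Relation.Unary.Unique.DecSetoid.Properties as DecUnique
open import Data.List.Relation.Unary.Unique.Propositional.Properties using (allFin⁺)
import Data.List.Relation.Unary.Unique.Setoid as SetoidUnique
import Data.List.Relation.Unary.Unique.Setoid.Properties as Unique
open import Data.Maybe using (Maybe; just; nothing)
open import Data.Nat as ℕ using (ℕ; zero; suc; _∸_; _≤_)
import Data.Nat.Properties as ℕ
open import Data.Product using (_×_; _,_; proj₁; proj₂)
open import Data.Vec using (Vec; []; _∷_; tabulate)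
open import Data.Vec.Properties using (tabulate-cong)
open import Function using (_∘_; id)
import Function.Endo.Propositional as Endo
open import Level using (0ℓ)
open import Relation.Binary using (DecSetoid; Setoid; Tri; tri<; tri≈; tri>)
open import Relation.Binary.PropositionalEquality as ≡ using (_≡_; _≢_; module ≡-Reasoning)
import Relation.Binary.Reasoning.Setoid as SetoidReasoning
open import Relation.Nullary using (¬_; Dec; does; yes; no; contradiction)
open import Relation.Nullary.Decidable using (dec-false; dec-true; _×-dec_)
open import Relation.Unary using (Pred) renaming (Decidable to Decidable₁)
open import Defs


-- Cycles

-- The sum over permutations is computed backwards: a function `G` of words is pulled back through
-- one insertion after another until only the empty word, that of n = 1, is left. Functions of words
-- extend multilinearly to linear combinations of letters, and there the pairing becomes visible:
-- the new letter is a descent or a fixed point with equal right, an ascent arises only from a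
-- valley and then together with a descent, and a peak changes no more. A fixed point counts both as
-- a cycle and as a fixed point, so it is free of q until an insertion breaks its loop; this is the
-- one place where `level` and `slope` behave differently. The obstacle is the bookkeeping of arcs.
-- Insertions are indexed by the target of the arc that they break, but the letter that changes is
-- the target of an arc going down and the source of an arc going up. The arcs going up must
-- therefore be reindexed, which stays within the inner elements because 0 → n is the only such arc
-- with an end outside.

module _ {a ℓ} (S : Setoid a ℓ) where
  open Setoid S
  open SetoidMembership S using (_∈_)
  open SetoidUnique S using (Unique)
  open SetoidPermutation S using (_↭_; ↭-refl; ↭-sym; ↭-trans; ↭-prep; ↭-reflexive-≋)

  -- Serves twice: to compare two systems of representatives of the cycles, and two enumerations of
  -- the permutations `σ ⋆`. The head of `xs` is located in `ys` and shifted to the front;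
  -- uniqueness then keeps it out of both remainders.
  unique⇒↭ : ∀ {xs ys} → Unique xs → Unique ys →
    (∀ {z} → z ∈ xs → z ∈ ys) → (∀ {z} → z ∈ ys → z ∈ xs) → xs ↭ ys
  unique⇒↭ {[]} {[]}     _ _ _ _ = ↭-refl
  unique⇒↭ {[]} {y ∷ ys} _ _ _ ys⊆ = contradiction (ys⊆ (here refl)) λ ()
  unique⇒↭ {x ∷ xs} {ys} (x∉xs ∷ xs!) ys! xs⊆ ys⊆
    with as , bs , w , x≈w , ys≋ ← ∈-∃++ S (xs⊆ (here refl)) =
    ↭-trans (↭-prep x (unique⇒↭ xs! rest! ⊆rest rest⊆)) (↭-sym ys↭)
    where
    ys↭ : ys ↭ x ∷ as ++ bs
    ys↭ = ↭-trans (↭-reflexive-≋ ys≋) (Permutation.shift S (sym x≈w) as bs)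

    x∷rest! : Unique (x ∷ as ++ bs)
    x∷rest! = Permutation.Unique-resp-↭ S ys↭ ys!

    rest! : Unique (as ++ bs)
    rest! with _ ∷ u ← x∷rest! = u

    ⊆rest : ∀ {z} → z ∈ xs → z ∈ as ++ bs
    ⊆rest z∈xs with Permutation.∈-resp-↭ S ys↭ (xs⊆ (there z∈xs))
    ... | here z≈x  = contradiction (Any.map (trans (sym z≈x)) z∈xs) (All.All¬⇒¬Any x∉xs)
    ... | there z∈  = z∈

    rest⊆ : ∀ {z} → z ∈ as ++ bs → z ∈ xs
    rest⊆ z∈ with ys⊆ (Permutation.∈-resp-↭ S (↭-sym ys↭) (there z∈)) | x∷rest!
    ... | here z≈x  | x∉ ∷ _ = contradiction (Any.map (trans (sym z≈x)) z∈) (All.All¬⇒¬Any x∉)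
    ... | there z∈′ | _      = z∈′

module _ {m : ℕ} (π : Permutation′ m) where

  open Endo (Fin m) using (_^_; ^-homo)

  private
    infixr 9 _↑_
    _↑_ : ℕ → Fin m → Fin m
    k ↑ i = ((π ⟨$⟩ʳ_) ^ k) i

    ↑-+ : ∀ a b i → (a ℕ.+ b) ↑ i ≡ a ↑ b ↑ i
    ↑-+ a b i = ≡.cong-app (^-homo (π ⟨$⟩ʳ_) a b) i

    π-injective : ∀ {i j} → π ⟨$⟩ʳ i ≡ π ⟨$⟩ʳ j → i ≡ j
    π-injective eq = ≡.trans (≡.sym (inverseˡ π)) (≡.trans (≡.cong (π ⟨$⟩ˡ_) eq) (inverseˡ π))

    ↑-injective : ∀ k {i j} → k ↑ i ≡ k ↑ j → i ≡ j
    ↑-injective zero    eq = eq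
    ↑-injective (suc k) eq = ↑-injective k (π-injective eq)

  sameCycle-refl : ∀ {i} → SameCycle π i i
  sameCycle-refl = 0 , ≡.refl

  sameCycle-step : ∀ {i j} → π ⟨$⟩ʳ i ≡ j → SameCycle π i j
  sameCycle-step eq = 1 , eq

  sameCycle-trans : ∀ {i j k} → SameCycle π i j → SameCycle π j k → SameCycle π i k
  sameCycle-trans (a , ≡.refl) (b , ≡.refl) = b ℕ.+ a , ↑-+ b a _

  private
    -- By pigeonhole two iterates of `i` agree; cancelling the common steps shows that `suc d` steps
    -- fix `i`, so `d` steps lead back from its image.
    sameCycle-back : ∀ i → SameCycle π (π ⟨$⟩ʳ i) i
    sameCycle-back i with pigeonhole (ℕ.n<1+n m) (λ a → toℕ a ↑ i)
    ... | a , b , a<b , eq with d , a+d≡b ← ℕ.m≤n⇒∃[o]m+o≡n a<b = d , ≡.sym (↑-injective (toℕ a) (≡.trans eq (≡.trans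
      (≡.cong (_↑ i) (≡.trans (≡.sym a+d≡b) (≡.trans (≡.sym (ℕ.+-suc (toℕ a) d)) (≡.cong (toℕ a ℕ.+_) (ℕ.+-comm 1 d)))))
      (≡.trans (↑-+ (toℕ a) (d ℕ.+ 1) i) (≡.cong (toℕ a ↑_) (↑-+ d 1 i))))))

  sameCycle-sym : ∀ {i j} → SameCycle π i j → SameCycle π j i
  sameCycle-sym {i} (k , ≡.refl) = go k
    where
    go : ∀ k → SameCycle π (k ↑ i) i
    go zero    = sameCycle-refl
    go (suc k) = sameCycle-trans (sameCycle-back (k ↑ i)) (go k)

  cycles : DecSetoid 0ℓ 0ℓ
  cycles = record
    { _≈_ = SameCycle π
    ; isDecEquivalence = record
      { isEquivalence = record { refl = sameCycle-refl ; sym = sameCycle-sym ; trans = sameCycle-trans }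
      ; _≟_ = sameCycle? π
      }
    }

  open DecSetoid cycles using (setoid)
  open SetoidUnique setoid using (Unique)

  representatives : List (Fin m)
  representatives = deduplicate (sameCycle? π) (allFin m)

  representatives-unique : Unique representatives
  representatives-unique = DecUnique.deduplicate-! cycles (allFin m)

  representatives-complete : IsEnumeration setoid representatives
  representatives-complete = Enumerates.deduplicate⁺ cycles λ i →
    Any.map (λ { ≡.refl → sameCycle-refl }) (∈-allFin i)

  -- Frees the count of cycles from the particular list produced by `deduplicate`: any transversal
  -- will do, such as the image of another one under a renaming.
  cyc≡length : ∀ {zs} → Unique zs → IsEnumeration setoid zs → cyc π ≡ length zs
  cyc≡length zs! zs-complete = Permutation.xs↭ys⇒|xs|≡|ys| setoid
    (unique⇒↭ setoid representatives-unique zs! (λ _ → zs-complete _) (λ _ → representatives-complete _))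

-- A step of `π` need not become a step of `ρ`, only stay within a cycle. This admits both the
-- renaming `old`, which may stretch a step to two, and the contraction `merge`, which may collapse
-- one.
sameCycle-map : ∀ {m n} (π : Permutation′ m) (ρ : Permutation′ n) (f : Fin m → Fin n) →
  (∀ i → SameCycle ρ (f i) (f (π ⟨$⟩ʳ i))) → ∀ {i j} → SameCycle π i j → SameCycle ρ (f i) (f j)
sameCycle-map π ρ f step (zero  , ≡.refl) = sameCycle-refl ρ
sameCycle-map π ρ f step (suc k , ≡.refl) =
  sameCycle-trans ρ (sameCycle-map π ρ f step (k , ≡.refl)) (step _)

-- Insertion of a new smallest element

module _ {n : ℕ} where

  transpose-left : ∀ (i j : Fin n) → Components.transpose i j i ≡ j
  transpose-left i j rewrite dec-true (i ≟ i) ≡.refl = ≡.refl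

  transpose-right : ∀ (i j : Fin n) → Components.transpose i j j ≡ i
  transpose-right i j with j ≟ i
  ... | yes j≡i = j≡i
  ... | no  _ rewrite dec-true (j ≟ j) ≡.refl = ≡.refl

  transpose-other : ∀ {i j k : Fin n} → k ≢ i → k ≢ j → Components.transpose i j k ≡ k
  transpose-other {i} {j} {k} k≢i k≢j rewrite dec-false (k ≟ i) k≢i | dec-false (k ≟ j) k≢j = ≡.refl

⟨$⟩ˡ-unique : ∀ {n} (π : Permutation′ n) {i j} → π ⟨$⟩ʳ i ≡ j → π ⟨$⟩ˡ j ≡ i
⟨$⟩ˡ-unique π ≡.refl = inverseˡ π

cyc-cong : ∀ {n} {π ρ : Permutation′ n} → π ≈ₚ ρ → cyc π ≡ cyc ρ
cyc-cong {π = π} {ρ} π≈ρ = ≡.trans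
  (cyc≡length π
    (Unique.map⁺ setoidρ setoidπ (sameCycle-map π ρ id λ i → sameCycle-step ρ (≡.sym (π≈ρ i)))
      (representatives-unique ρ))
    (λ i → Any.map⁺ (Any.map (sameCycle-map ρ π id λ j → sameCycle-step π (π≈ρ j))
      (representatives-complete ρ i))))
  (length-map id (representatives ρ))
  where
  open DecSetoid (cycles ρ) using () renaming (setoid to setoidρ)
  open DecSetoid (cycles π) using () renaming (setoid to setoidπ)

new : ∀ {n} → Fin (2 ℕ.+ n)
new = suc zero

old : ∀ {n} → Fin (suc n) → Fin (2 ℕ.+ n)
old = punchIn new

old≢new : ∀ {n} (x : Fin (suc n)) → old x ≢ new
old≢new = punchInᵢ≢i new

-- The element 1 is inserted into the permutation π of {0,…,n} as the new
-- predecessor of c, the old elements 1,…,n being renamed 2,…,n+1; for c = 1 it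
-- becomes a fixed point.
ins : ∀ {n} → Permutation′ (suc n) → Fin (2 ℕ.+ n) → Permutation′ (2 ℕ.+ n)
ins π c = insert new new π ∘ₚ transpose new c

module _ {n : ℕ} (π : Permutation′ (suc n)) (c : Fin (2 ℕ.+ n)) where

  ins-new : ins π c ⟨$⟩ʳ new ≡ c
  ins-new = transpose-left new c

  ins-hit : ∀ {x} → old (π ⟨$⟩ʳ x) ≡ c → ins π c ⟨$⟩ʳ old x ≡ new
  ins-hit {x} eq = ≡.trans
    (≡.cong (Components.transpose new c) (≡.trans (insert-punchIn new new π x) eq))
    (transpose-right new c)

  ins-miss : ∀ {x} → old (π ⟨$⟩ʳ x) ≢ c → ins π c ⟨$⟩ʳ old x ≡ old (π ⟨$⟩ʳ x)
  ins-miss {x} neq = ≡.trans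
    (≡.cong (Components.transpose new c) (insert-punchIn new new π x))
    (transpose-other (old≢new _) neq)

  ins⁻¹-target : ins π c ⟨$⟩ˡ c ≡ new
  ins⁻¹-target = ⟨$⟩ˡ-unique (ins π c) ins-new

  ins⁻¹-new : ∀ {y} → old y ≡ c → ins π c ⟨$⟩ˡ new ≡ old (π ⟨$⟩ˡ y)
  ins⁻¹-new eq = ⟨$⟩ˡ-unique (ins π c) (ins-hit (≡.trans (≡.cong old (inverseʳ π)) eq))

  ins⁻¹-old : ∀ {x} → old x ≢ c → ins π c ⟨$⟩ˡ old x ≡ old (π ⟨$⟩ˡ x)
  ins⁻¹-old neq = ⟨$⟩ˡ-unique (ins π c)
    (≡.trans (ins-miss (neq ∘ ≡.trans (≡.cong old (≡.sym (inverseʳ π))))) (≡.cong old (inverseʳ π)))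

-- A left inverse of `old` that contracts the new element onto `y`, the element it is made to
-- precede.
merge : ∀ {n} → Fin (suc n) → Fin (2 ℕ.+ n) → Fin (suc n)
merge y zero          = zero
merge y (suc zero)    = y
merge y (suc (suc x)) = suc x

merge-old : ∀ {n} (y x : Fin (suc n)) → merge y (old x) ≡ x
merge-old y zero    = ≡.refl
merge-old y (suc x) = ≡.refl

data OldOrNew {n} : Fin (2 ℕ.+ n) → Set where
  isNew : OldOrNew new
  isOld : ∀ x → OldOrNew (old x)

oldOrNew : ∀ {n} (x : Fin (2 ℕ.+ n)) → OldOrNew x
oldOrNew zero          = isOld zero
oldOrNew (suc zero)    = isNew
oldOrNew (suc (suc x)) = isOld (suc x)

module _ {n : ℕ} (π : Permutation′ (suc n)) where

  open DecSetoid (cycles π) using () renaming (setoid to setoidπ)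

  module _ (y : Fin (suc n)) where
    private
      π′ = ins π (old y)
      open DecSetoid (cycles π′) using () renaming (setoid to setoidπ′)

      merge-step : ∀ x → SameCycle π (merge y x) (merge y (π′ ⟨$⟩ʳ x))
      merge-step x with oldOrNew x
      ... | isNew rewrite ins-new π (old y) | merge-old y y = sameCycle-refl π
      ... | isOld z with π ⟨$⟩ʳ z ≟ y
      ...   | yes eq rewrite ins-hit π (old y) (≡.cong old eq) | merge-old y z = sameCycle-step π eq
      ...   | no neq rewrite ins-miss π (old y) (neq ∘ punchIn-injective new _ _) | merge-old y z
                             | merge-old y (π ⟨$⟩ʳ z) = sameCycle-step π ≡.refl

      old-step : ∀ x → SameCycle π′ (old x) (old (π ⟨$⟩ʳ x))
      old-step x with π ⟨$⟩ʳ x ≟ y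
      ... | yes ≡.refl = sameCycle-trans π′ (sameCycle-step π′ (ins-hit π (old y) ≡.refl))
                         (sameCycle-step π′ (ins-new π (old y)))
      ... | no neq   = sameCycle-step π′ (ins-miss π (old y) (neq ∘ punchIn-injective new _ _))

      old-merge : ∀ x → SameCycle π′ x (old (merge y x))
      old-merge zero          = sameCycle-refl π′
      old-merge (suc zero)    = sameCycle-step π′ (ins-new π (old y))
      old-merge (suc (suc x)) = sameCycle-refl π′

    -- The renamed representatives remain a transversal: `old` and `merge y` both preserve cycles,
    -- and the new element joins the cycle of `y`.
    cyc-ins-old : cyc (ins π (old y)) ≡ cyc π
    cyc-ins-old = ≡.trans
      (cyc≡length π′
        (Unique.map⁺ setoidπ setoidπ′
          (λ s → ≡.subst₂ (SameCycle π) (merge-old y _) (merge-old y _)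
            (sameCycle-map π′ π (merge y) merge-step s))
          (representatives-unique π))
        (λ x → Any.map⁺ (Any.map
          (λ s → sameCycle-trans π′ (old-merge x) (sameCycle-map π π′ old old-step s))
          (representatives-complete π (merge y x)))))
      (length-map old (representatives π))

  private
    π′ = ins π new
    open DecSetoid (cycles π′) using () renaming (setoid to setoidπ′)

    ins-new-old : ∀ x → π′ ⟨$⟩ʳ old x ≡ old (π ⟨$⟩ʳ x)
    ins-new-old x = ins-miss π new (old≢new _)

    -- The new element is fixed here, so it could be contracted onto any old element; `zero` is an
    -- arbitrary choice.
    merge-step : ∀ x → SameCycle π (merge zero x) (merge zero (π′ ⟨$⟩ʳ x))
    merge-step x with oldOrNew x
    ... | isNew rewrite ins-new π new = sameCycle-refl π
    ... | isOld z rewrite ins-new-old z | merge-old zero z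
                          | merge-old zero (π ⟨$⟩ʳ z) = sameCycle-step π ≡.refl

  cyc-ins-new : cyc (ins π new) ≡ suc (cyc π)
  cyc-ins-new = ≡.trans
    (cyc≡length π′
      (All.map⁺ (All.universal (λ z s → old≢new z
          (sameCycle-fixed π′ (ins-new π new) (sameCycle-sym π′ s))) (representatives π))
        ∷ Unique.map⁺ setoidπ setoidπ′
          (λ s → ≡.subst₂ (SameCycle π) (merge-old zero _) (merge-old zero _)
            (sameCycle-map π′ π (merge zero) merge-step s))
          (representatives-unique π))
      complete)
    (≡.cong suc (length-map old (representatives π)))
    where
    complete : ∀ x → Any.Any (SameCycle π′ x) (new ∷ map old (representatives π))
    complete x with oldOrNew x
    ... | isNew   = here (sameCycle-refl π′)
    ... | isOld z = there (Any.map⁺ (Any.map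
      (sameCycle-map π π′ old (λ i → sameCycle-step π′ (ins-new-old i)))
      (representatives-complete π z)))

-- Functions of words

-- The letter  arcs i o  describes an inner element whose incoming arc goes up
-- iff i holds and whose outgoing arc goes up iff o holds.
data Letter : Set where
  fixed : Letter
  arcs  : (in↑ out↑ : Bool) → Letter

pattern peak   = arcs true  false
pattern valley = arcs false true
pattern ascent = arcs true  true
pattern descent = arcs false false

-- Linear combinations of letters: level stands for descent + fixed and slope
-- for descent + ascent.
data Letter⁺ : Set where
  level slope peak⁺ valley⁺ : Letter⁺

module Words {c ℓ} (R : CommutativeRing c ℓ) (q : CommutativeRing.Carrier R) where

  open CommutativeRing R hiding (zero)
  open GeneratingFunctions R hiding (A)
  open SetoidReasoning setoid
  open SemigroupProperties +-commutativeSemigroup using (interchange)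
  open SemigroupProperties *-commutativeSemigroup
    using (x∙yz≈y∙xz) renaming (interchange to *-interchange)

  when : Bool → Carrier → Carrier
  when b x = if b then x else 0#

  Functional : Set → ℕ → Set c
  Functional X m = Vec X m → Carrier

  -- A smaller element inserted before a letter makes its incoming arc go up,
  -- and inserted after it makes its outgoing arc go down.  A fixed point becomes
  -- a peak on a nontrivial cycle, which is counted by the factor q.
  bend : Letter → (Letter → Carrier) → Carrier
  bend fixed      h = q * h peak
  bend (arcs i o) h = when (not i) (h (arcs true o)) + when o (h (arcs i false))

  δ : ∀ {m} → Functional Letter m → Functional Letter m
  δ G []      = 0#
  δ G (x ∷ w) = bend x (λ y → G (y ∷ w)) + δ (G ∘ (x ∷_)) w

  -- The transpose of one insertion, with one summand for each kind of target: 0, the new element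
  -- itself, an inner element. The new letter comes first because the new element is the smallest
  -- inner one.
  T : ∀ {m} → Functional Letter (suc m) → Functional Letter m
  T G w = G (descent ∷ w) + G (fixed ∷ w) + δ (G ∘ (valley ∷_)) w

  run : ∀ m → Functional Letter m → Carrier
  run zero    G = G []
  run (suc m) G = run m (T G)

  bend⁺ : Letter⁺ → (Letter⁺ → Carrier) → Carrier
  bend⁺ level   h = h peak⁺ + q * h peak⁺
  bend⁺ slope   h = h peak⁺ + h peak⁺
  bend⁺ peak⁺   h = 0#
  bend⁺ valley⁺ h = h slope

  δ⁺ : ∀ {m} → Functional Letter⁺ m → Functional Letter⁺ m
  δ⁺ F []      = 0#
  δ⁺ F (x ∷ w) = bend⁺ x (λ y → F (y ∷ w)) + δ⁺ (F ∘ (x ∷_)) w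

  T⁺ : ∀ {m} → Functional Letter⁺ (suc m) → Functional Letter⁺ m
  T⁺ F w = F (level ∷ w) + δ⁺ (F ∘ (valley⁺ ∷_)) w

  run⁺ : ∀ m → Functional Letter⁺ m → Carrier
  run⁺ zero    F = F []
  run⁺ (suc m) F = run⁺ m (T⁺ F)

  expand : Letter⁺ → (Letter → Carrier) → Carrier
  expand level   h = h descent + h fixed
  expand slope   h = h descent + h ascent
  expand peak⁺   h = h peak
  expand valley⁺ h = h valley

  -- The multilinear extension of `G` to words in the combined letters.
  extend : ∀ {m} → Functional Letter m → Functional Letter⁺ m
  extend G []      = G []
  extend G (x ∷ w) = expand x λ y → extend (G ∘ (y ∷_)) w

  expand-cong : ∀ x {g h} → (∀ y → g y ≈ h y) → expand x g ≈ expand x h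
  expand-cong level   g≈h = +-cong (g≈h _) (g≈h _)
  expand-cong slope   g≈h = +-cong (g≈h _) (g≈h _)
  expand-cong peak⁺   g≈h = g≈h _
  expand-cong valley⁺ g≈h = g≈h _

  expand-+ : ∀ x g h → expand x (λ y → g y + h y) ≈ expand x g + expand x h
  expand-+ level   g h = interchange _ _ _ _
  expand-+ slope   g h = interchange _ _ _ _
  expand-+ peak⁺   g h = refl
  expand-+ valley⁺ g h = refl

  expand-* : ∀ x a h → expand x (λ y → a * h y) ≈ a * expand x h
  expand-* level   a h = sym (distribˡ a _ _)
  expand-* slope   a h = sym (distribˡ a _ _)
  expand-* peak⁺   a h = refl
  expand-* valley⁺ a h = refl

  expand-0 : ∀ x → expand x (λ _ → 0#) ≈ 0#
  expand-0 level   = +-identityʳ 0#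
  expand-0 slope   = +-identityʳ 0#
  expand-0 peak⁺   = refl
  expand-0 valley⁺ = refl

  extend-cong : ∀ {m} {G H : Functional Letter m} → (∀ w → G w ≈ H w) → ∀ w → extend G w ≈ extend H w
  extend-cong G≈H []      = G≈H []
  extend-cong G≈H (x ∷ w) = expand-cong x λ y → extend-cong (G≈H ∘ (y ∷_)) w

  extend-+ : ∀ {m} (G H : Functional Letter m) w → extend (λ v → G v + H v) w ≈ extend G w + extend H w
  extend-+ G H []      = refl
  extend-+ G H (x ∷ w) = trans
    (expand-cong x λ y → extend-+ (G ∘ (y ∷_)) (H ∘ (y ∷_)) w)
    (expand-+ x _ _)

  extend-* : ∀ {m} a (G : Functional Letter m) w → extend (λ v → a * G v) w ≈ a * extend G w
  extend-* a G []      = refl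
  extend-* a G (x ∷ w) = trans (expand-cong x λ y → extend-* a (G ∘ (y ∷_)) w) (expand-* x a _)

  extend-0 : ∀ {m} (w : Vec Letter⁺ m) → extend (λ _ → 0#) w ≈ 0#
  extend-0 []      = refl
  extend-0 (x ∷ w) = trans (expand-cong x λ _ → extend-0 w) (expand-0 x)

  extend-when : ∀ {m} b (G : Functional Letter m) w → extend (λ v → when b (G v)) w ≈ when b (extend G w)
  extend-when true  G w = refl
  extend-when false G w = extend-0 w

  extend-bend : ∀ {m} x (G : Letter → Functional Letter m) w →
    extend (λ v → bend x (λ y → G y v)) w ≈ bend x (λ y → extend (G y) w)
  extend-bend fixed      G w = extend-* q (G peak) w
  extend-bend (arcs i o) G w = trans (extend-+ _ _ w)
    (+-cong (extend-when (not i) _ w) (extend-when o _ w))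

  -- The closure property behind the choice of combined letters. Descents and ascents bend to a peak
  -- in one way each, and a valley bends to one ascent and one descent, which is exactly `slope`.
  expand-bend : ∀ x h → expand x (λ y → bend y h) ≈ bend⁺ x (λ y → expand y h)
  expand-bend level   h = +-congʳ (+-identityʳ _)
  expand-bend slope   h = +-cong (+-identityʳ _) (+-identityˡ _)
  expand-bend peak⁺   h = +-identityʳ 0#
  expand-bend valley⁺ h = +-comm _ _

  bend⁺-cong : ∀ x {g h} → (∀ y → g y ≈ h y) → bend⁺ x g ≈ bend⁺ x h
  bend⁺-cong level   g≈h = +-cong (g≈h _) (*-congˡ (g≈h _))
  bend⁺-cong slope   g≈h = +-cong (g≈h _) (g≈h _)
  bend⁺-cong peak⁺   g≈h = refl
  bend⁺-cong valley⁺ g≈h = g≈h _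

  bend⁺-+ : ∀ x g h → bend⁺ x (λ y → g y + h y) ≈ bend⁺ x g + bend⁺ x h
  bend⁺-+ level   g h = trans (+-congˡ (distribˡ q _ _)) (interchange _ _ _ _)
  bend⁺-+ slope   g h = interchange _ _ _ _
  bend⁺-+ peak⁺   g h = sym (+-identityʳ 0#)
  bend⁺-+ valley⁺ g h = refl

  δ⁺-cong : ∀ {m} {F H : Functional Letter⁺ m} → (∀ w → F w ≈ H w) → ∀ w → δ⁺ F w ≈ δ⁺ H w
  δ⁺-cong F≈H []      = refl
  δ⁺-cong F≈H (x ∷ w) = +-cong (bend⁺-cong x λ y → F≈H (y ∷ w)) (δ⁺-cong (F≈H ∘ (x ∷_)) w)

  δ⁺-+ : ∀ {m} (F H : Functional Letter⁺ m) w → δ⁺ (λ v → F v + H v) w ≈ δ⁺ F w + δ⁺ H w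
  δ⁺-+ F H []      = sym (+-identityʳ 0#)
  δ⁺-+ F H (x ∷ w) = trans
    (+-cong (bend⁺-+ x _ _) (δ⁺-+ (F ∘ (x ∷_)) (H ∘ (x ∷_)) w))
    (interchange _ _ _ _)

  δ⁺-expand : ∀ {m} x (F : Letter → Functional Letter⁺ m) w →
    expand x (λ y → δ⁺ (F y) w) ≈ δ⁺ (λ v → expand x (λ y → F y v)) w
  δ⁺-expand level   F w = sym (δ⁺-+ _ _ w)
  δ⁺-expand slope   F w = sym (δ⁺-+ _ _ w)
  δ⁺-expand peak⁺   F w = refl
  δ⁺-expand valley⁺ F w = refl

  extend-δ : ∀ {m} (G : Functional Letter m) w → extend (δ G) w ≈ δ⁺ (extend G) w
  extend-δ G []      = refl
  extend-δ G (x ∷ w) = begin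
    expand x (λ y → extend (λ v → bend y (λ z → G (z ∷ v)) + δ (G ∘ (y ∷_)) v) w)
      ≈⟨ expand-cong x (λ y → trans (extend-+ _ _ w)
           (+-cong (extend-bend y (λ z → G ∘ (z ∷_)) w) (extend-δ (G ∘ (y ∷_)) w))) ⟩
    expand x (λ y → bend y (λ z → extend (G ∘ (z ∷_)) w) + δ⁺ (extend (G ∘ (y ∷_))) w)
      ≈⟨ expand-+ x _ _ ⟩
    expand x (λ y → bend y (λ z → extend (G ∘ (z ∷_)) w)) + expand x (λ y → δ⁺ (extend (G ∘ (y ∷_))) w)
      ≈⟨ +-cong (expand-bend x _) (δ⁺-expand x _ w) ⟩
    δ⁺ (extend G) (x ∷ w) ∎

  extend-T : ∀ {m} (G : Functional Letter (suc m)) w → extend (T G) w ≈ T⁺ (extend G) w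
  extend-T G w = trans (extend-+ _ _ w) (+-cong (extend-+ _ _ w) (extend-δ (G ∘ (valley ∷_)) w))

  T⁺-cong : ∀ {m} {F H : Functional Letter⁺ (suc m)} → (∀ w → F w ≈ H w) → ∀ w → T⁺ F w ≈ T⁺ H w
  T⁺-cong F≈H w = +-cong (F≈H _) (δ⁺-cong (λ v → F≈H (valley⁺ ∷ v)) w)

  run⁺-cong : ∀ m {F H : Functional Letter⁺ m} → (∀ w → F w ≈ H w) → run⁺ m F ≈ run⁺ m H
  run⁺-cong zero    F≈H = F≈H []
  run⁺-cong (suc m) F≈H = run⁺-cong m (T⁺-cong F≈H)

  -- Each pull-back commutes with `extend`, and on the empty word `extend` does nothing, so the
  -- whole computation can be done with combined letters.
  run-extend : ∀ m (G : Functional Letter m) → run m G ≈ run⁺ m (extend G)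
  run-extend zero    G = refl
  run-extend (suc m) G = trans (run-extend m (T G)) (run⁺-cong m (extend-T G))

  -- Multiplicative weights and homogeneity

  weight : ∀ {X : Set} {m} → (X → Carrier) → Functional X m
  weight f []      = 1#
  weight f (x ∷ w) = f x * weight f w

  weight-cong : ∀ {X : Set} {m} {f g : X → Carrier} → (∀ x → f x ≈ g x) → ∀ (w : Vec X m) →
    weight f w ≈ weight g w
  weight-cong f≈g []      = refl
  weight-cong f≈g (x ∷ w) = *-cong (f≈g x) (weight-cong f≈g w)

  -- Letters are expanded independently of each other, so a product of letter weights turns into the
  -- product of the summed weights.
  extend-weight : ∀ {m} (f : Letter → Carrier) (w : Vec Letter⁺ m) →
    extend (weight f) w ≈ weight (λ x → expand x f) w
  extend-weight f []      = refl
  extend-weight f (x ∷ w) = begin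
    expand x (λ y → extend (λ v → f y * weight f v) w) ≈⟨ expand-cong x (λ y → extend-* (f y) (weight f) w) ⟩
    expand x (λ y → f y * extend (weight f) w)         ≈⟨ expand-cong x (λ y → *-comm _ _) ⟩
    expand x (λ y → extend (weight f) w * f y)         ≈⟨ expand-* x _ f ⟩
    extend (weight f) w * expand x f                   ≈⟨ *-comm _ _ ⟩
    expand x f * extend (weight f) w                   ≈⟨ *-congˡ (extend-weight f w) ⟩
    weight (λ x → expand x f) (x ∷ w)                  ∎

  -- Every summand of T⁺ raises the degree by one.
  degree : Letter⁺ → ℕ
  degree level   = 1
  degree slope   = 1
  degree peak⁺   = 2
  degree valley⁺ = 0

  degreeʷ : ∀ {m} → Vec Letter⁺ m → ℕ
  degreeʷ []      = 0
  degreeʷ (x ∷ w) = degree x ℕ.+ degreeʷ w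

  -- The offset `j` is the degree gained in the insertions that have already been pulled back.
  Rescaled : ∀ {m} → Carrier → ℕ → (F′ F : Functional Letter⁺ m) → Set ℓ
  Rescaled a j F′ F = ∀ w → F′ w ≈ a ^ (degreeʷ w ℕ.+ j) * F w

  module _ {a : Carrier} where

    rescaled-∷ : ∀ {m j} {F′ F : Functional Letter⁺ (suc m)} → Rescaled a j F′ F →
      ∀ x → Rescaled a (degree x ℕ.+ j) (F′ ∘ (x ∷_)) (F ∘ (x ∷_))
    rescaled-∷ {j = j} {F = F} eq x w = trans (eq (x ∷ w)) (*-congʳ (reflexive (≡.cong (a ^_) (exponent x))))
      where
      exponent : ∀ x → degree x ℕ.+ degreeʷ w ℕ.+ j ≡ degreeʷ w ℕ.+ (degree x ℕ.+ j)
      exponent x = ≡.trans (≡.cong (ℕ._+ j) (ℕ.+-comm (degree x) _)) (ℕ.+-assoc (degreeʷ w) (degree x) j)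

    -- Bending leads from degree 0 to 1 (valley to slope) or from 1 to 2 (level or slope to peak); a
    -- peak bends to zero, where any factor is right.
    rescaled-bend⁺ : ∀ x j d {h′ h} → (∀ y → h′ y ≈ a ^ (degree y ℕ.+ d ℕ.+ j) * h y) →
      bend⁺ x h′ ≈ a ^ (suc (degree x) ℕ.+ d ℕ.+ j) * bend⁺ x h
    rescaled-bend⁺ level j d eq = trans
      (+-cong (eq peak⁺) (trans (*-congˡ (eq peak⁺)) (x∙yz≈y∙xz _ _ _)))
      (sym (distribˡ _ _ _))
    rescaled-bend⁺ slope j d eq = trans (+-cong (eq peak⁺) (eq peak⁺)) (sym (distribˡ _ _ _))
    rescaled-bend⁺ peak⁺ j d eq = sym (zeroʳ _)
    rescaled-bend⁺ valley⁺ j d eq = eq slope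

    rescaled-δ⁺ : ∀ {m j} {F′ F : Functional Letter⁺ m} → Rescaled a j F′ F → Rescaled a (suc j) (δ⁺ F′) (δ⁺ F)
    rescaled-δ⁺ eq [] = sym (zeroʳ _)
    rescaled-δ⁺ {j = j} {F′} {F} eq (x ∷ w) = begin
      bend⁺ x (λ y → F′ (y ∷ w)) + δ⁺ (F′ ∘ (x ∷_)) w
        ≈⟨ +-cong (rescaled-bend⁺ x j (degreeʷ w) (λ y → eq (y ∷ w)))
             (rescaled-δ⁺ (rescaled-∷ {F′ = F′} {F} eq x) w) ⟩
      a ^ (suc (degree x) ℕ.+ degreeʷ w ℕ.+ j) * _ + a ^ (degreeʷ w ℕ.+ suc (degree x ℕ.+ j)) * _
        ≈⟨ +-cong (*-congʳ (power (≡.sym (ℕ.+-suc (degree x ℕ.+ degreeʷ w) j))))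
             (*-congʳ (power (exponent (degree x) (degreeʷ w)))) ⟩
      a ^ (degree x ℕ.+ degreeʷ w ℕ.+ suc j) * _ + a ^ (degree x ℕ.+ degreeʷ w ℕ.+ suc j) * _
        ≈⟨ distribˡ _ _ _ ⟨
      a ^ (degreeʷ (x ∷ w) ℕ.+ suc j) * δ⁺ F (x ∷ w) ∎
      where
      power : ∀ {k l} → k ≡ l → a ^ k ≈ a ^ l
      power ≡.refl = refl
      exponent : ∀ k l → l ℕ.+ suc (k ℕ.+ j) ≡ k ℕ.+ l ℕ.+ suc j
      exponent k l = ≡.trans (≡.cong (l ℕ.+_) (≡.sym (ℕ.+-suc k j)))
        (≡.trans (≡.sym (ℕ.+-assoc l k (suc j))) (≡.cong (ℕ._+ suc j) (ℕ.+-comm l k)))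

    -- The degree grows by one in either way: `level` has degree one itself, while `valley⁺` has
    -- degree zero but comes with one bent letter.
    rescaled-T⁺ : ∀ {m j} {F′ F : Functional Letter⁺ (suc m)} → Rescaled a j F′ F → Rescaled a (suc j) (T⁺ F′) (T⁺ F)
    rescaled-T⁺ {j = j} {F′} {F} eq w = trans
      (+-cong (rescaled-∷ {F′ = F′} {F} eq level w) (rescaled-δ⁺ (rescaled-∷ {F′ = F′} {F} eq valley⁺) w))
      (sym (distribˡ _ _ _))

    rescaled-run⁺ : ∀ m {j} {F′ F : Functional Letter⁺ m} → Rescaled a j F′ F →
      run⁺ m F′ ≈ a ^ (m ℕ.+ j) * run⁺ m F
    rescaled-run⁺ zero eq = eq []
    rescaled-run⁺ (suc m) {j} {F′} {F} eq = trans (rescaled-run⁺ m (rescaled-T⁺ {F′ = F′} {F} eq))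
      (*-congʳ (reflexive (≡.cong (a ^_) (ℕ.+-suc m j))))

  weight⁺ : (s y : Carrier) → Letter⁺ → Carrier
  weight⁺ s y level   = s
  weight⁺ s y slope   = s
  weight⁺ s y peak⁺   = y
  weight⁺ s y valley⁺ = 1#

  rescaled-weight : ∀ {m a s y s′ y′} → s′ ≈ a * s → y′ ≈ a * (a * y) →
    Rescaled {m} a 0 (weight (weight⁺ s′ y′)) (weight (weight⁺ s y))
  rescaled-weight eqs eqy [] = sym (*-identityʳ 1#)
  rescaled-weight {a = a} {s} {y} {s′} {y′} eqs eqy (x ∷ w) = begin
    weight⁺ s′ y′ x * weight (weight⁺ s′ y′) w
      ≈⟨ *-cong (letter x) (rescaled-weight eqs eqy w) ⟩
    (a ^ degree x * weight⁺ s y x) * (a ^ (degreeʷ w ℕ.+ 0) * weight (weight⁺ s y) w)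
      ≈⟨ *-interchange _ _ _ _ ⟩
    (a ^ degree x * a ^ (degreeʷ w ℕ.+ 0)) * weight (weight⁺ s y) (x ∷ w)
      ≈⟨ *-congʳ (Exp.^-homo-* semiring a (degree x) _) ⟨
    a ^ (degree x ℕ.+ (degreeʷ w ℕ.+ 0)) * weight (weight⁺ s y) (x ∷ w)
      ≈⟨ *-congʳ (reflexive (≡.cong (a ^_) (≡.sym (ℕ.+-assoc (degree x) _ 0)))) ⟩
    a ^ (degreeʷ (x ∷ w) ℕ.+ 0) * weight (weight⁺ s y) (x ∷ w) ∎
    where
    letter : ∀ x → weight⁺ s′ y′ x ≈ a ^ degree x * weight⁺ s y x
    letter level   = trans eqs (*-congʳ (sym (*-identityʳ a)))
    letter slope   = trans eqs (*-congʳ (sym (*-identityʳ a)))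
    letter peak⁺   = trans eqy (trans (sym (*-assoc a a y)) (*-congʳ (*-congˡ (sym (*-identityʳ a)))))
    letter valley⁺ = sym (*-identityʳ 1#)

  Γ : ℕ → Carrier → Carrier → Carrier
  Γ m s y = run⁺ m (weight (weight⁺ s y))

  Γ-rescaled : ∀ m {a s y s′ y′} → s′ ≈ a * s → y′ ≈ a * (a * y) → Γ m s′ y′ ≈ a ^ m * Γ m s y
  Γ-rescaled m {a} eqs eqy = trans (rescaled-run⁺ m (rescaled-weight eqs eqy))
    (*-congʳ (reflexive (≡.cong (a ^_) (ℕ.+-identityʳ m))))

  Γ-cong : ∀ m {s y s′ y′} → s ≈ s′ → y ≈ y′ → Γ m s y ≈ Γ m s′ y′
  Γ-cong m eqs eqy = run⁺-cong m (weight-cong λ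
    { level → eqs ; slope → eqs ; peak⁺ → eqy ; valley⁺ → refl })

  letterWeight : (x t : Carrier) → Letter → Carrier
  letterWeight x t fixed   = t
  letterWeight x t peak    = x * t
  letterWeight x t ascent  = t
  letterWeight x t valley  = 1#
  letterWeight x t descent = 1#

  run≈Γ : ∀ m x t → run m (weight (letterWeight x t)) ≈ Γ m (1# + t) (x * t)
  run≈Γ m x t = trans (run-extend m _) (run⁺-cong m λ w →
    trans (extend-weight (letterWeight x t) w) (weight-cong expanded w))
    where
    expanded : ∀ y → expand y (letterWeight x t) ≈ weight⁺ (1# + t) (x * t) y
    expanded level   = refl
    expanded slope   = refl
    expanded peak⁺   = refl
    expanded valley⁺ = refl

-- Words of permutations

inner : ∀ {m} → Fin m → Fin (2 ℕ.+ m)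
inner i = suc (inject₁ i)

infix 4 _<ᵇ_ _≡ᵇ_
_<ᵇ_ _≡ᵇ_ : ∀ {n} → Fin n → Fin n → Bool
i <ᵇ j = does (i Fin.<? j)
i ≡ᵇ j = does (i ≟ j)

<ᵇ-irrefl : ∀ {n} (i : Fin n) → (i <ᵇ i) ≡ false
<ᵇ-irrefl i = dec-false (i Fin.<? i) (Fin.<-irrefl ≡.refl)

-- The letter at x in a permutation sending p to x and x to s.
letterOf : ∀ {n} (p x s : Fin n) → Letter
letterOf p x s = if s ≡ᵇ x then fixed else arcs (p <ᵇ x) (x <ᵇ s)

letter : ∀ {n} → Permutation′ n → Fin n → Letter
letter π x = letterOf (π ⟨$⟩ˡ x) x (π ⟨$⟩ʳ x)

spell : ∀ {m} → (Fin (2 ℕ.+ m) → Letter) → Vec Letter m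
spell u = tabulate (u ∘ inner)

word : ∀ {m} → Permutation′ (2 ℕ.+ m) → Vec Letter m
word π = spell (letter π)

infixl 6 _[_≔_]
_[_≔_] : ∀ {n} {A : Set} → (Fin n → A) → Fin n → A → Fin n → A
(u [ x ≔ a ]) z = if z ≡ᵇ x then a else u z

≔-hit : ∀ {n} {A : Set} (u : Fin n → A) {x z a} → z ≡ x → (u [ x ≔ a ]) z ≡ a
≔-hit u {x} {z} z≡x rewrite dec-true (z ≟ x) z≡x = ≡.refl

≔-miss : ∀ {n} {A : Set} (u : Fin n → A) {x z a} → z ≢ x → (u [ x ≔ a ]) z ≡ u z
≔-miss u {x} {z} z≢x rewrite dec-false (z ≟ x) z≢x = ≡.refl

old-<ᵇ : ∀ {n} (x y : Fin (suc n)) → (old x <ᵇ old y) ≡ (x <ᵇ y)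
old-<ᵇ zero    zero    = ≡.refl
old-<ᵇ zero    (suc y) = ≡.refl
old-<ᵇ (suc x) zero    = ≡.refl
old-<ᵇ (suc x) (suc y) = ≡.refl

old-≡ᵇ : ∀ {n} (x y : Fin (suc n)) → (old x ≡ᵇ old y) ≡ (x ≡ᵇ y)
old-≡ᵇ zero    zero    = ≡.refl
old-≡ᵇ zero    (suc y) = ≡.refl
old-≡ᵇ (suc x) zero    = ≡.refl
old-≡ᵇ (suc x) (suc y) = ≡.refl

letterOf-old : ∀ {n} (p x s : Fin (suc n)) → letterOf (old p) (old x) (old s) ≡ letterOf p x s
letterOf-old p x s rewrite old-≡ᵇ s x | old-<ᵇ p x | old-<ᵇ x s = ≡.refl

letter-cong : ∀ {n} {π ρ : Permutation′ n} → π ≈ₚ ρ → ∀ x → letter π x ≡ letter ρ x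
letter-cong {π = π} {ρ} π≈ρ x = ≡.cong₂ (λ p s → letterOf p x s)
  (⟨$⟩ˡ-unique π (≡.trans (π≈ρ _) (inverseʳ ρ))) (π≈ρ x)

word-cong : ∀ {m} {π ρ : Permutation′ (2 ℕ.+ m)} → π ≈ₚ ρ → word π ≡ word ρ
word-cong {π = π} {ρ} π≈ρ = tabulate-cong λ i → letter-cong {π = π} {ρ} π≈ρ (inner i)

module _ {m : ℕ} (π : Permutation′ (2 ℕ.+ m)) where

  word-ins-new : word (ins π new) ≡ fixed ∷ word π
  word-ins-new = ≡.cong₂ _∷_ head (tabulate-cong tail)
    where
    head : letter (ins π new) new ≡ fixed
    head rewrite ins-new π new = ≡.refl
    tail : ∀ i → letter (ins π new) (old (inner i)) ≡ letter π (inner i)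
    tail i rewrite ins-miss π new {inner i} (old≢new _)
                 | ins⁻¹-old π new {inner i} (old≢new (inner i))
                 = letterOf-old (π ⟨$⟩ˡ inner i) (inner i) (π ⟨$⟩ʳ inner i)

  module _ (0↦last : π ⟨$⟩ʳ zero ≡ fromℕ (suc m)) where

    -- Ensures that the predecessor handed to the new element lies above it, so that its incoming
    -- arc goes down.
    pred≢0 : ∀ {y} → y ≢ fromℕ (suc m) → π ⟨$⟩ˡ y ≢ zero
    pred≢0 y≢last eq = y≢last (≡.trans (≡.sym (inverseʳ π)) (≡.trans (≡.cong (π ⟨$⟩ʳ_) eq) 0↦last))

    -- The arc into 0 goes down and still goes down once it is redirected to the new element, so no
    -- old letter changes.
    word-ins-zero : word (ins π (old zero)) ≡ descent ∷ word π
    word-ins-zero = ≡.cong₂ _∷_ head (tabulate-cong tail)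
      where
      head : letter (ins π (old zero)) new ≡ descent
      head rewrite ins-new π (old zero) | ins⁻¹-new π (old zero) {zero} ≡.refl with π ⟨$⟩ˡ zero in eq
      ... | zero  = contradiction eq (pred≢0 λ ())
      ... | suc _ = ≡.refl
      tail : ∀ i → letter (ins π (old zero)) (old (inner i)) ≡ letter π (inner i)
      tail i rewrite ins⁻¹-old π (old zero) {inner i} (λ ()) with π ⟨$⟩ʳ inner i ≟ zero
      ... | yes eq rewrite ins-hit π (old zero) {inner i} (≡.cong old eq) | eq
                   = ≡.cong (λ b → arcs b false) (old-<ᵇ (π ⟨$⟩ˡ inner i) (inner i))
      ... | no neq rewrite ins-miss π (old zero) {inner i} (neq ∘ Fin.punchIn-injective new _ _)
                   = letterOf-old (π ⟨$⟩ˡ inner i) (inner i) (π ⟨$⟩ʳ inner i)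

    module _ (i : Fin m) where
      private
        y  = inner i
        a  = π ⟨$⟩ˡ y
        π′ = ins π (old y)

        y≢last : y ≢ fromℕ (suc m)
        y≢last eq = Fin.fromℕ≢inject₁ (≡.sym (Fin.suc-injective eq))

        head : letter π′ new ≡ valley
        head rewrite ins-new π (old y) | ins⁻¹-new π (old y) {y} ≡.refl with π ⟨$⟩ˡ y in eq
        ... | zero  = contradiction eq (pred≢0 y≢last)
        ... | suc _ = ≡.refl

        pred-old : ∀ {x} → x ≢ y → π′ ⟨$⟩ˡ old x ≡ old (π ⟨$⟩ˡ x)
        pred-old x≢y = ins⁻¹-old π (old y) (x≢y ∘ Fin.punchIn-injective new _ _)

        succ-old : ∀ {x} → π ⟨$⟩ʳ x ≢ y → π′ ⟨$⟩ʳ old x ≡ old (π ⟨$⟩ʳ x)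
        succ-old πx≢y = ins-miss π (old y) (πx≢y ∘ Fin.punchIn-injective new _ _)

        letter-other : ∀ {x} → x ≢ y → π ⟨$⟩ʳ x ≢ y → letter π′ (old x) ≡ letter π x
        letter-other {x} x≢y πx≢y rewrite pred-old x≢y | succ-old πx≢y = letterOf-old (π ⟨$⟩ˡ x) x (π ⟨$⟩ʳ x)

        letter-source : ∀ {j} → inner j ≢ y → π ⟨$⟩ʳ inner j ≡ y →
          letter π′ (old (inner j)) ≡ arcs (π ⟨$⟩ˡ inner j <ᵇ inner j) false
        letter-source {j} x≢y πx≡y rewrite pred-old x≢y | ins-hit π (old y) {inner j} (≡.cong old πx≡y)
          = ≡.cong (λ b → arcs b false) (old-<ᵇ (π ⟨$⟩ˡ inner j) (inner j))

        letter-target : π ⟨$⟩ʳ y ≢ y → letter π′ (old y) ≡ arcs true (y <ᵇ π ⟨$⟩ʳ y)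
        letter-target πy≢y rewrite ins⁻¹-target π (old y) | succ-old πy≢y
          | old-≡ᵇ (π ⟨$⟩ʳ y) y | dec-false (π ⟨$⟩ʳ y ≟ y) πy≢y
          = ≡.cong (arcs true) (old-<ᵇ y (π ⟨$⟩ʳ y))

        letter-loop : π ⟨$⟩ʳ y ≡ y → letter π′ (old y) ≡ peak
        letter-loop πy≡y rewrite ins⁻¹-target π (old y) | ins-hit π (old y) {y} (≡.cong old πy≡y) = ≡.refl

      -- The loop at `y` opens to a 2-cycle with the smaller new element, on which `y` is a peak.
      word-ins-loop : π ⟨$⟩ʳ inner i ≡ inner i →
        word (ins π (old (inner i))) ≡ valley ∷ spell (letter π [ inner i ≔ peak ])
      word-ins-loop πy≡y = ≡.cong₂ _∷_ head (tabulate-cong tail)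
        where
        tail : ∀ j → letter π′ (old (inner j)) ≡ (letter π [ y ≔ peak ]) (inner j)
        tail j with inner j ≟ y
        ... | yes x≡y = ≡.trans (≡.cong (letter π′ ∘ old) x≡y)
          (≡.trans (letter-loop πy≡y) (≡.sym (≔-hit (letter π) x≡y)))
        ... | no  x≢y = ≡.trans
          (letter-other x≢y λ πx≡y → x≢y (≡.trans (≡.sym (⟨$⟩ˡ-unique π πx≡y)) (⟨$⟩ˡ-unique π πy≡y)))
          (≡.sym (≔-miss (letter π) x≢y))

      -- The source of a broken down arc still descends, now to the new element; only the target
      -- sees a change, being entered from below.
      word-ins-down : (inner i) Fin.< (π ⟨$⟩ˡ inner i) →
        word (ins π (old (inner i))) ≡
          valley ∷ spell (letter π [ inner i ≔ arcs true (inner i <ᵇ π ⟨$⟩ʳ inner i) ])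
      word-ins-down y<a = ≡.cong₂ _∷_ head (tabulate-cong tail)
        where
        πy≢y : π ⟨$⟩ʳ y ≢ y
        πy≢y eq = Fin.<-irrefl (≡.sym (⟨$⟩ˡ-unique π eq)) y<a
        tail : ∀ j → letter π′ (old (inner j)) ≡ (letter π [ y ≔ arcs true (y <ᵇ π ⟨$⟩ʳ y) ]) (inner j)
        tail j with inner j ≟ y
        ... | yes x≡y = ≡.trans (≡.cong (letter π′ ∘ old) x≡y)
          (≡.trans (letter-target πy≢y) (≡.sym (≔-hit (letter π) x≡y)))
        ... | no  x≢y with π ⟨$⟩ʳ inner j ≟ y
        ...   | no πx≢y = ≡.trans (letter-other x≢y πx≢y) (≡.sym (≔-miss (letter π) x≢y))
        ...   | yes πx≡y = ≡.trans (letter-source x≢y πx≡y)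
          (≡.trans (≡.sym unchanged) (≡.sym (≔-miss (letter π) x≢y)))
          where
          y<x : y Fin.< inner j
          y<x = ≡.subst (y Fin.<_) (⟨$⟩ˡ-unique π πx≡y) y<a
          unchanged : letter π (inner j) ≡ arcs (π ⟨$⟩ˡ inner j <ᵇ inner j) false
          unchanged rewrite πx≡y | dec-false (y ≟ inner j) (x≢y ∘ ≡.sym)
            | dec-false (inner j Fin.<? y) (Fin.<-asym y<x) = ≡.refl

      -- The target of a broken up arc is still entered from below, now from the new element; only
      -- the source sees a change, since it now descends.
      word-ins-up : (π ⟨$⟩ˡ inner i) Fin.< (inner i) →
        word (ins π (old (inner i))) ≡
          valley ∷ spell (letter π [ a ≔ arcs (π ⟨$⟩ˡ a <ᵇ a) false ])
      word-ins-up a<y = ≡.cong₂ _∷_ head (tabulate-cong tail)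
        where
        πy≢y : π ⟨$⟩ʳ y ≢ y
        πy≢y eq = Fin.<-irrefl (⟨$⟩ˡ-unique π eq) a<y
        unchanged : letter π y ≡ arcs true (y <ᵇ π ⟨$⟩ʳ y)
        unchanged rewrite dec-false (π ⟨$⟩ʳ y ≟ y) πy≢y | dec-true (a Fin.<? y) a<y = ≡.refl
        tail : ∀ j → letter π′ (old (inner j)) ≡ (letter π [ a ≔ arcs (π ⟨$⟩ˡ a <ᵇ a) false ]) (inner j)
        tail j = go (inner j ≟ a) (inner j ≟ y)
          where
          go : Dec (inner j ≡ a) → Dec (inner j ≡ y) →
            letter π′ (old (inner j)) ≡ (letter π [ a ≔ arcs (π ⟨$⟩ˡ a <ᵇ a) false ]) (inner j)
          go (yes x≡a) _ = ≡.trans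
            (letter-source (λ x≡y → Fin.<-irrefl (≡.trans (≡.sym x≡a) x≡y) a<y)
              (≡.trans (≡.cong (π ⟨$⟩ʳ_) x≡a) (inverseʳ π)))
            (≡.trans (≡.cong (λ x → arcs (π ⟨$⟩ˡ x <ᵇ x) false) x≡a) (≡.sym (≔-hit (letter π) x≡a)))
          go (no x≢a) (no x≢y) = ≡.trans
            (letter-other x≢y λ πx≡y → x≢a (≡.sym (⟨$⟩ˡ-unique π πx≡y)))
            (≡.sym (≔-miss (letter π) x≢a))
          go (no x≢a) (yes x≡y) = ≡.trans (≡.cong (letter π′ ∘ old) x≡y) (≡.trans (letter-target πy≢y)
            (≡.sym (≡.trans (≔-miss (letter π) x≢a) (≡.trans (≡.cong (letter π) x≡y) unchanged))))

-- Cycle counts and letter counts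

open SemigroupProperties ℕ.+-commutativeSemigroup using () renaming (x∙yz≈y∙xz to +-leftSwap)

-- Opaque, because conversion checking would otherwise unfold cyc.
opaque
  cyc# : ∀ {n} → Permutation′ n → ℕ
  cyc# = cyc

  cyc#≡cyc : ∀ {n} (π : Permutation′ n) → cyc# π ≡ cyc π
  cyc#≡cyc π = ≡.refl

  cyc#-cong : ∀ {n} {π ρ : Permutation′ n} → π ≈ₚ ρ → cyc# π ≡ cyc# ρ
  cyc#-cong {π = π} {ρ} = cyc-cong {π = π} {ρ}

  cyc#-ins-old : ∀ {n} (π : Permutation′ (suc n)) y → cyc# (ins π (old y)) ≡ cyc# π
  cyc#-ins-old = cyc-ins-old

  cyc#-ins-new : ∀ {n} (π : Permutation′ (suc n)) → cyc# (ins π new) ≡ suc (cyc# π)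
  cyc#-ins-new = cyc-ins-new

tally : ∀ {m} → (Letter → ℕ) → Vec Letter m → ℕ
tally k []      = 0
tally k (x ∷ w) = k x ℕ.+ tally k w

tally-cong : ∀ {m} k {u v : Fin m → Letter} → (∀ i → k (u i) ≡ k (v i)) →
  tally k (tabulate u) ≡ tally k (tabulate v)
tally-cong {zero}  k eq = ≡.refl
tally-cong {suc m} k eq = ≡.cong₂ ℕ._+_ (eq zero) (tally-cong k (eq ∘ suc))

tally-≔ : ∀ {m} k (u : Fin m → Letter) i x →
  k (u i) ℕ.+ tally k (tabulate (u [ i ≔ x ])) ≡ k x ℕ.+ tally k (tabulate u)
tally-≔ k u zero    x = +-leftSwap (k (u zero)) (k x) (tally k (tabulate (u ∘ suc)))
tally-≔ k u (suc i) x = ≡.trans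
  (+-leftSwap (k (u (suc i))) (k (u zero)) (tally k (tabulate ((u ∘ suc) [ i ≔ x ]))))
  (≡.trans (≡.cong (k (u zero) ℕ.+_) (tally-≔ k (u ∘ suc) i x))
    (+-leftSwap (k (u zero)) (k x) (tally k (tabulate (u ∘ suc)))))

module _ {n : ℕ} (π : Permutation′ n) {x : Fin n} where

  letter-fixed : π ⟨$⟩ʳ x ≡ x → letter π x ≡ fixed
  letter-fixed eq rewrite dec-true (π ⟨$⟩ʳ x ≟ x) eq = ≡.refl

  letter-arcs : π ⟨$⟩ʳ x ≢ x → letter π x ≡ arcs ((π ⟨$⟩ˡ x) <ᵇ x) (x <ᵇ (π ⟨$⟩ʳ x))
  letter-arcs neq rewrite dec-false (π ⟨$⟩ʳ x ≟ x) neq = ≡.refl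

isFixed : Letter → ℕ
isFixed fixed      = 1
isFixed (arcs _ _) = 0

fixes : ∀ {m} → Vec Letter m → ℕ
fixes = tally isFixed

spell-≔ : ∀ {m} (u : Fin (2 ℕ.+ m) → Letter) i x →
  spell (u [ inner i ≔ x ]) ≡ tabulate ((u ∘ inner) [ i ≔ x ])
spell-≔ u i x = tabulate-cong λ j → ≡.cong (λ b → if b then x else u (inner j)) (inject₁-≡ᵇ j i)
  where
  inject₁-≡ᵇ : ∀ {n} (j i : Fin n) → (inject₁ j ≡ᵇ inject₁ i) ≡ (j ≡ᵇ i)
  inject₁-≡ᵇ zero    zero    = ≡.refl
  inject₁-≡ᵇ zero    (suc i) = ≡.refl
  inject₁-≡ᵇ (suc j) zero    = ≡.refl
  inject₁-≡ᵇ (suc j) (suc i) = inject₁-≡ᵇ j i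

fixes-≔ : ∀ {m} (u : Fin (2 ℕ.+ m) → Letter) {x i o} → isFixed (u x) ≡ 0 →
  fixes (spell (u [ x ≔ arcs i o ])) ≡ fixes (spell u)
fixes-≔ u {x} {i} {o} ux = tally-cong isFixed λ j → go (inner j)
  where
  go : ∀ z → isFixed ((u [ x ≔ arcs i o ]) z) ≡ isFixed (u z)
  go z with z ≟ x
  ... | yes ≡.refl = ≡.sym ux
  ... | no  _    = ≡.refl

module _ {c ℓ} (M : CommutativeMonoid c ℓ) where

  open CommutativeMonoid M
  open MonoidSum M using (sum; sum-permute; sum-init-last; sum-cong-≗)
  open SetoidReasoning setoid

  -- Besides 0 → n, the arcs going up start and end at inner elements.
  sum-up : ∀ {m} (π : Permutation′ (2 ℕ.+ m)) → π ⟨$⟩ʳ zero ≡ fromℕ (suc m) →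
    (f : Fin (2 ℕ.+ m) → Carrier) →
    f zero ∙ sum (λ i → if inner i <ᵇ (π ⟨$⟩ʳ inner i) then f (inner i) else ε) ≈
    f zero ∙ sum (λ i → if (π ⟨$⟩ˡ inner i) <ᵇ inner i then f (π ⟨$⟩ˡ inner i) else ε)
  sum-up {m} π 0↦last f = begin
    f zero ∙ sum (source ∘ inner)
      ≈⟨ ∙-congˡ (identityʳ _) ⟨
    f zero ∙ (sum (source ∘ inner) ∙ ε)
      ≡⟨ ≡.cong₂ (λ a b → a ∙ (sum (source ∘ inner) ∙ b)) source-zero source-last ⟨
    source zero ∙ (sum (source ∘ inner) ∙ source (fromℕ (suc m)))
      ≈⟨ ∙-congˡ (sum-init-last (source ∘ suc)) ⟨
    sum source
      ≡⟨ sum-cong-≗ (λ x → ≡.cong (λ p → if p <ᵇ (π ⟨$⟩ʳ x) then f p else ε) (inverseˡ π {x})) ⟨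
    sum (target ∘ (π ⟨$⟩ʳ_))
      ≈⟨ sum-permute target π ⟨
    sum target
      ≈⟨ ∙-congˡ (sum-init-last (target ∘ suc)) ⟩
    ε ∙ (sum (target ∘ inner) ∙ target (fromℕ (suc m)))
      ≈⟨ identityˡ _ ⟩
    sum (target ∘ inner) ∙ target (fromℕ (suc m))
      ≡⟨ ≡.cong (sum (target ∘ inner) ∙_) target-last ⟩
    sum (target ∘ inner) ∙ f zero
      ≈⟨ comm _ _ ⟩
    f zero ∙ sum (target ∘ inner) ∎
    where
    source target : Fin (2 ℕ.+ m) → Carrier
    source x = if x <ᵇ (π ⟨$⟩ʳ x) then f x else ε
    target x = if (π ⟨$⟩ˡ x) <ᵇ x then f (π ⟨$⟩ˡ x) else ε

    source-zero : source zero ≡ f zero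
    source-zero rewrite 0↦last = ≡.refl

    source-last : source (fromℕ (suc m)) ≡ ε
    source-last rewrite dec-false (fromℕ (suc m) Fin.<? (π ⟨$⟩ʳ fromℕ (suc m)))
      (ℕ.≤⇒≯ (Fin.≤fromℕ (π ⟨$⟩ʳ fromℕ (suc m)))) = ≡.refl

    target-last : target (fromℕ (suc m)) ≡ f zero
    target-last rewrite ⟨$⟩ˡ-unique π 0↦last = ≡.refl

-- The insertions into one permutation, summed

module Step {c ℓ} (R : CommutativeRing c ℓ) (q : CommutativeRing.Carrier R) where

  open CommutativeRing R hiding (zero)
  open GeneratingFunctions R hiding (A)
  open Words R q
  open SemiringSum semiring using (sum; sum-cong-≋; ∑-distrib-+; *-distribˡ-sum)
  open SetoidReasoning setoid
  open AbelianGroupProperties +-abelianGroup using (∙-cancelˡ)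

  ∑-allFin : ∀ {n} (f : Fin n → Carrier) → ∑ (allFin n) f ≡ sum f
  ∑-allFin f = go f id
    where
    go : ∀ {n} {A : Set} (f : A → Carrier) (g : Fin n → A) → ∑ (List.tabulate g) f ≡ sum (f ∘ g)
    go {zero}  f g = ≡.refl
    go {suc n} f g = ≡.cong (f (g zero) +_) (go f (g ∘ suc))

  -- These are all targets but the last element, whose incoming arc 0 → n must stay intact.
  ∑-targets : ∀ {m} (F : Fin (3 ℕ.+ m) → Carrier) →
    ∑ (allFin (2 ℕ.+ m)) (λ x → F (inject₁ x)) ≡ F (old zero) + (F new + sum (λ i → F (old (inner i))))
  ∑-targets F = ∑-allFin (F ∘ inject₁)

  sum-scaled : ∀ {n a} {f g : Fin n → Carrier} → (∀ i → f i ≈ a * g i) → sum f ≈ a * sum g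
  sum-scaled {a = a} {g = g} eq = trans (sum-cong-≋ eq) (sym (*-distribˡ-sum a g))

  -- Puts the derivation into the form of a sum over inner elements, to be matched with the sum over
  -- insertion targets.
  δ-tabulate : ∀ {m} (G : Functional Letter m) u →
    δ G (tabulate u) ≈ sum (λ i → bend (u i) λ x → G (tabulate (u [ i ≔ x ])))
  δ-tabulate {zero}  G u = refl
  δ-tabulate {suc m} G u = +-congˡ (δ-tabulate (G ∘ (u zero ∷_)) (u ∘ suc))

  when-true : ∀ {b x} → b ≡ true → when b x ≈ x
  when-true ≡.refl = refl

  when-false : ∀ {b x} → b ≡ false → when b x ≈ 0#
  when-false ≡.refl = refl

  -- The number of cycles cannot be read off the word, so the power of q is kept apart from `G`.
  H : ∀ {m} → Functional Letter m → Permutation′ (2 ℕ.+ m) → Carrier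
  H G π = q ^ (cyc# π ∸ fixes (word π)) * G (word π)

  H-cong : ∀ {m} (G : Functional Letter m) {π ρ} → π ≈ₚ ρ → H G π ≈ H G ρ
  H-cong G {π} {ρ} π≈ρ = reflexive (≡.cong₂ (λ k w → q ^ (k ∸ fixes w) * G w)
    (cyc#-cong {π = π} {ρ} π≈ρ) (word-cong {π = π} {ρ} π≈ρ))

  module _ {m : ℕ} (π : Permutation′ (2 ℕ.+ m)) (0↦last : π ⟨$⟩ʳ zero ≡ fromℕ (suc m))
    (fixes≤cyc : fixes (word π) ≤ cyc# π) where

    private
      u = letter π
      Q = q ^ (cyc# π ∸ fixes (word π))

      H-arcs : ∀ (G : Functional Letter (suc m)) {ρ k i o w} → cyc# ρ ≡ k → word ρ ≡ arcs i o ∷ w →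
        H G ρ ≡ q ^ (k ∸ fixes w) * G (arcs i o ∷ w)
      H-arcs G eq eq′ = ≡.cong₂ (λ k w → q ^ (k ∸ fixes w) * G w) eq eq′

      -- A new fixed point raises both counts, and `suc k ∸ suc l` reduces to `k ∸ l`: the exponent
      -- of q does not move.
      H-fixed : ∀ (G : Functional Letter (suc m)) {ρ k w} → cyc# ρ ≡ suc k → word ρ ≡ fixed ∷ w →
        H G ρ ≡ q ^ (k ∸ fixes w) * G (fixed ∷ w)
      H-fixed G eq eq′ = ≡.cong₂ (λ k w → q ^ (k ∸ fixes w) * G w) eq eq′

    module _ (G : Functional Letter m) where

      private
        -- Values of `G` after breaking an arc: `down x` for a down arc ending at `x`, `up x` for an
        -- up arc starting at `x`.
        down up : Fin (2 ℕ.+ m) → Carrier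
        down x = G (spell (u [ x ≔ arcs true (x <ᵇ (π ⟨$⟩ʳ x)) ]))
        up   x = G (spell (u [ x ≔ arcs ((π ⟨$⟩ˡ x) <ᵇ x) false ]))

        loop : Fin m → Carrier
        loop i = G (spell (u [ inner i ≔ peak ]))

        rest : Fin m → Carrier
        rest i = when (inner i <ᵇ (π ⟨$⟩ˡ inner i)) (down (inner i))
               + when ((π ⟨$⟩ʳ inner i) ≡ᵇ inner i) (q * loop i)

      -- Splits the bendings of one letter by the arc involved. The part `rest` already sits at the
      -- target of its arc, as the sum over insertions requires; only the `up` part has to be
      -- reindexed.
      bend-letter : ∀ i →
        bend (u (inner i)) (λ x → G (tabulate ((u ∘ inner) [ i ≔ x ]))) ≈
        when (inner i <ᵇ (π ⟨$⟩ʳ inner i)) (up (inner i)) + rest i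
      bend-letter i = trans (bend-≡ (u y) (λ x → ≡.cong G (≡.sym (spell-≔ u i x)))) (go (π ⟨$⟩ʳ y ≟ y))
        where
        y = inner i
        h = λ x → G (spell (u [ y ≔ x ]))
        bend-≡ : ∀ z {g h} → (∀ x → g x ≡ h x) → bend z g ≈ bend z h
        bend-≡ fixed      eq = *-congˡ (reflexive (eq peak))
        bend-≡ (arcs i o) eq = reflexive (≡.cong₂ (λ a b → when (not i) a + when o b) (eq _) (eq _))
        go : Dec (π ⟨$⟩ʳ y ≡ y) → bend (u y) h ≈ when (y <ᵇ (π ⟨$⟩ʳ y)) (up y) + rest i
        go (yes eq) = begin
          bend (u y) h ≡⟨ ≡.cong (λ l → bend l h) (letter-fixed π eq) ⟩
          q * loop i   ≈⟨ trans (+-identityˡ _) (+-identityˡ _) ⟨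
          0# + (0# + q * loop i)
            ≈⟨ +-cong (when-false (≡.trans (≡.cong (y <ᵇ_) eq) (<ᵇ-irrefl y)))
                (+-cong (when-false (≡.trans (≡.cong (y <ᵇ_) (⟨$⟩ˡ-unique π eq)) (<ᵇ-irrefl y)))
                        (when-true (dec-true (π ⟨$⟩ʳ y ≟ y) eq))) ⟨
          when (y <ᵇ (π ⟨$⟩ʳ y)) (up y) + rest i ∎
        go (no neq) = begin
          bend (u y) h
            ≡⟨ ≡.cong (λ l → bend l h) (letter-arcs π neq) ⟩
          when (not ((π ⟨$⟩ˡ y) <ᵇ y)) (down y) + when (y <ᵇ (π ⟨$⟩ʳ y)) (up y)
            ≈⟨ +-comm _ _ ⟩
          when (y <ᵇ (π ⟨$⟩ʳ y)) (up y) + when (not ((π ⟨$⟩ˡ y) <ᵇ y)) (down y)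
            ≈⟨ +-congˡ (trans (reflexive (≡.cong (λ b → when b (down y)) not<)) (sym (+-identityʳ _))) ⟩
          when (y <ᵇ (π ⟨$⟩ʳ y)) (up y) + (when (y <ᵇ (π ⟨$⟩ˡ y)) (down y) + 0#)
            ≈⟨ +-congˡ (+-congˡ (when-false (dec-false (π ⟨$⟩ʳ y ≟ y) neq))) ⟨
          when (y <ᵇ (π ⟨$⟩ʳ y)) (up y) + rest i ∎
          where
          not< : not ((π ⟨$⟩ˡ y) <ᵇ y) ≡ (y <ᵇ (π ⟨$⟩ˡ y))
          not< with Fin.<-cmp (π ⟨$⟩ˡ y) y
          ... | tri< a<y _ a≯y = ≡.trans (≡.cong not (dec-true (_ Fin.<? _) a<y)) (≡.sym (dec-false (_ Fin.<? _) a≯y))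
          ... | tri≈ _ a≡y _   = contradiction (≡.trans (≡.cong (π ⟨$⟩ʳ_) (≡.sym a≡y)) (inverseʳ π)) neq
          ... | tri> a≮y _ a>y = ≡.trans (≡.cong not (dec-false (_ Fin.<? _) a≮y)) (≡.sym (dec-true (_ Fin.<? _) a>y))

      δ-word : δ G (word π) ≈
        sum (λ i → when ((π ⟨$⟩ˡ inner i) <ᵇ inner i) (up (π ⟨$⟩ˡ inner i)) + rest i)
      δ-word = begin
        δ G (word π) ≈⟨ δ-tabulate G (u ∘ inner) ⟩
        sum (λ i → bend (u (inner i)) λ x → G (tabulate ((u ∘ inner) [ i ≔ x ])))
          ≈⟨ sum-cong-≋ bend-letter ⟩
        sum (λ i → when (inner i <ᵇ (π ⟨$⟩ʳ inner i)) (up (inner i)) + rest i)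
          ≈⟨ ∑-distrib-+ _ rest ⟩
        sum (λ i → when (inner i <ᵇ (π ⟨$⟩ʳ inner i)) (up (inner i))) + sum rest
          -- Both sides of `sum-up` contain the term of the forbidden arc 0 → n; it is cancelled in
          -- the additive group.
          ≈⟨ +-congʳ (∙-cancelˡ (up zero) _ _ (sum-up +-commutativeMonoid π 0↦last up)) ⟩
        sum (λ i → when ((π ⟨$⟩ˡ inner i) <ᵇ inner i) (up (π ⟨$⟩ˡ inner i))) + sum rest
          ≈⟨ ∑-distrib-+ _ rest ⟨
        sum (λ i → when ((π ⟨$⟩ˡ inner i) <ᵇ inner i) (up (π ⟨$⟩ˡ inner i)) + rest i) ∎

    isFixed-u : ∀ {x} → π ⟨$⟩ʳ x ≢ x → isFixed (u x) ≡ 0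
    isFixed-u neq = ≡.cong isFixed (letter-arcs π neq)

    module _ (G : Functional Letter (suc m)) (i : Fin m) where

      private
        y = inner i
        a = π ⟨$⟩ˡ y
        π′ = ins π (old y)
        g = G ∘ (valley ∷_)

        fromUp   = when (a <ᵇ y) (g (spell (u [ a ≔ arcs ((π ⟨$⟩ˡ a) <ᵇ a) false ])))
        fromDown = when (y <ᵇ a) (g (spell (u [ y ≔ arcs true (y <ᵇ (π ⟨$⟩ʳ y)) ])))
        fromLoop = when ((π ⟨$⟩ʳ y) ≡ᵇ y) (q * g (spell (u [ y ≔ peak ])))

      H-ins-inner : H G (ins π (old y)) ≈ Q * (fromUp + (fromDown + fromLoop))
      H-ins-inner = go (Fin.<-cmp a y)
        where
        go : Tri (a Fin.< y) (a ≡ y) (y Fin.< a) → H G π′ ≈ Q * (fromUp + (fromDown + fromLoop))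
        go (tri< a<y a≢y a≯y) = begin
          H G π′ ≡⟨ H-arcs G {π′} (cyc#-ins-old π y) (word-ins-up π 0↦last i a<y) ⟩
          q ^ (cyc# π ∸ fixes (spell (u [ a ≔ _ ]))) * z
            ≡⟨ ≡.cong (λ k → q ^ (cyc# π ∸ k) * z) (fixes-≔ u (isFixed-u (λ eq → a≢y (≡.trans (≡.sym eq) (inverseʳ π))))) ⟩
          Q * z ≈⟨ *-congˡ (trans (+-cong (when-true (dec-true (a Fin.<? y) a<y))
                     (trans (+-cong (when-false (dec-false (y Fin.<? a) a≯y))
                       (when-false (dec-false (π ⟨$⟩ʳ y ≟ y) (a≢y ∘ ⟨$⟩ˡ-unique π)))) (+-identityʳ 0#)))
                     (+-identityʳ z)) ⟨
          _ ∎
          where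
          z = G (valley ∷ spell (u [ a ≔ arcs ((π ⟨$⟩ˡ a) <ᵇ a) false ]))
        go (tri> a≮y a≢y a>y) = begin
          H G π′ ≡⟨ H-arcs G {π′} (cyc#-ins-old π y) (word-ins-down π 0↦last i a>y) ⟩
          q ^ (cyc# π ∸ fixes (spell (u [ y ≔ _ ]))) * z
            ≡⟨ ≡.cong (λ k → q ^ (cyc# π ∸ k) * z) (fixes-≔ u (isFixed-u (a≢y ∘ ⟨$⟩ˡ-unique π))) ⟩
          Q * z ≈⟨ *-congˡ (trans (+-cong (when-false (dec-false (a Fin.<? y) a≮y))
                     (trans (+-cong (when-true (dec-true (y Fin.<? a) a>y))
                       (when-false (dec-false (π ⟨$⟩ʳ y ≟ y) (a≢y ∘ ⟨$⟩ˡ-unique π)))) (+-identityʳ z)))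
                     (+-identityˡ z)) ⟨
          _ ∎
          where
          z = G (valley ∷ spell (u [ y ≔ arcs true (y <ᵇ (π ⟨$⟩ʳ y)) ]))
        go (tri≈ a≮y a≡y a≯y) = begin
          H G π′ ≡⟨ H-arcs G {π′} (cyc#-ins-old π y) (word-ins-loop π 0↦last i πy≡y) ⟩
          q ^ (cyc# π ∸ fixes w′) * z
            -- Breaking the loop loses a fixed point but no cycle, so the exponent grows by one:
            -- this is the q in `bend fixed`. The bound `fixes≤cyc` keeps truncation from spoiling
            -- the count.
            ≡⟨ ≡.cong (λ k → q ^ k * z) (exponent (≡.subst (_≤ cyc# π) fixes≡ fixes≤cyc)) ⟩
          q * q ^ (cyc# π ∸ suc (fixes w′)) * z ≡⟨ ≡.cong (λ k → q * q ^ (cyc# π ∸ k) * z) fixes≡ ⟨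
          q * Q * z   ≈⟨ trans (*-congʳ (*-comm q Q)) (*-assoc Q q z) ⟩
          Q * (q * z) ≈⟨ *-congˡ (trans (+-cong (when-false (dec-false (a Fin.<? y) a≮y))
                     (trans (+-cong (when-false (dec-false (y Fin.<? a) a≯y))
                       (when-true (dec-true (π ⟨$⟩ʳ y ≟ y) πy≡y))) (+-identityˡ (q * z))))
                     (+-identityˡ (q * z))) ⟨
          _ ∎
          where
          w′ = spell (u [ y ≔ peak ])
          z = G (valley ∷ w′)
          πy≡y : π ⟨$⟩ʳ y ≡ y
          πy≡y = ≡.trans (≡.cong (π ⟨$⟩ʳ_) (≡.sym a≡y)) (inverseʳ π)
          fixes≡ : fixes (word π) ≡ suc (fixes w′)
          fixes≡ = ≡.trans (≡.sym (tally-≔ isFixed (u ∘ inner) i peak))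
            (≡.cong₂ (λ k w → isFixed k ℕ.+ fixes w) (letter-fixed π πy≡y) (≡.sym (spell-≔ u i peak)))
          exponent : ∀ {k l} → suc l ≤ k → k ∸ l ≡ suc (k ∸ suc l)
          exponent {suc k} (ℕ.s≤s l≤k) = ℕ.+-∸-assoc 1 l≤k

    H-ins-zero : ∀ G → H G (ins π (old zero)) ≡ Q * G (descent ∷ word π)
    H-ins-zero G = H-arcs G {ins π (old zero)} (cyc#-ins-old π zero) (word-ins-zero π 0↦last)

    H-ins-new : ∀ G → H G (ins π new) ≡ Q * G (fixed ∷ word π)
    H-ins-new G = H-fixed G {ins π new} (cyc#-ins-new π) (word-ins-new π)

    ∑-H-ins-inner : ∀ G → sum (λ i → H G (ins π (old (inner i)))) ≈ Q * δ (G ∘ (valley ∷_)) (word π)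
    ∑-H-ins-inner G = trans (sum-scaled (H-ins-inner G)) (*-congˡ (sym (δ-word (G ∘ (valley ∷_)))))

    ∑-ins : ∀ G → ∑ (allFin (2 ℕ.+ m)) (λ x → H G (ins π (inject₁ x))) ≈ Q * T G (word π)
    ∑-ins G = begin
      ∑ (allFin (2 ℕ.+ m)) (λ x → H G (ins π (inject₁ x)))
        ≡⟨ ∑-targets (λ x → H G (ins π x)) ⟩
      H G (ins π (old zero)) + (H G (ins π new) + sum (λ i → H G (ins π (old (inner i)))))
        ≈⟨ +-cong (reflexive (H-ins-zero G)) (+-cong (reflexive (H-ins-new G)) (∑-H-ins-inner G)) ⟩
      Q * G (descent ∷ word π) + (Q * G (fixed ∷ word π) + Q * δ (G ∘ (valley ∷_)) (word π))
        ≈⟨ trans (+-congˡ (sym (distribˡ Q _ _))) (sym (distribˡ Q _ _)) ⟩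
      Q * (G (descent ∷ word π) + (G (fixed ∷ word π) + δ (G ∘ (valley ∷_)) (word π)))
        ≈⟨ *-congˡ (sym (+-assoc _ _ _)) ⟩
      Q * T G (word π) ∎

-- Sums over all permutations

permutations : ℕ → Setoid 0ℓ 0ℓ
permutations n = record
  { Carrier = Permutation′ n
  ; _≈_ = _≈ₚ_
  ; isEquivalence = record
    { refl = λ _ → ≡.refl
    ; sym = λ eq i → ≡.sym (eq i)
    ; trans = λ eq eq′ i → ≡.trans (eq i) (eq′ i)
    }
  }

FromZeroToLast : ∀ {n} → Permutation′ (suc n) → Set
FromZeroToLast {n} π = π ⟨$⟩ʳ zero ≡ fromℕ n

⋆-injective : ∀ {n} {σ τ : Permutation′ n} → σ ⋆ ≈ₚ τ ⋆ → σ ≈ₚ τ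
⋆-injective {σ = σ} {τ} eq i = inject₁-injective (≡.trans (≡.sym (⋆-suc σ i)) (≡.trans (eq (suc i)) (⋆-suc τ i)))

stars : ∀ n → List (Permutation′ (suc n))
stars n = map _⋆ (𝔖 n)

stars-unique : ∀ n → AllPairs (λ π ρ → ¬ (π ≈ₚ ρ)) (stars n)
stars-unique n = AllPairs.map⁺ (AllPairs.map (λ {σ} {τ} σ≉τ → σ≉τ ∘ ⋆-injective {σ = σ} {τ}) (𝔖-distinct n))

stars-complete : ∀ {n} (π : Permutation′ (suc n)) → FromZeroToLast π → Any (π ≈ₚ_) (stars n)
stars-complete {n} π 0↦last = Any.map⁺ (Any.map (λ {τ} → step τ) (𝔖-complete (remove zero π)))
  where
  step : ∀ τ → remove zero π ≈ₚ τ → π ≈ₚ τ ⋆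
  step τ eq zero    = 0↦last
  step τ eq (suc i) = ≡.trans (≡.sym (insert-remove zero π (suc i))) (≡.cong₂ punchIn 0↦last (eq i))

insertionsInto : ∀ {m} → Permutation′ (suc m) → List (Permutation′ (3 ℕ.+ m))
insertionsInto {m} σ = map (λ x → ins (σ ⋆) (inject₁ x)) (allFin (2 ℕ.+ m))

insertions : ∀ m → List (Permutation′ (3 ℕ.+ m))
insertions m = concatMap insertionsInto (𝔖 (suc m))

ins-target-injective : ∀ {n} {π ρ : Permutation′ (suc n)} {c d} → ins π c ≈ₚ ins ρ d → c ≡ d
ins-target-injective {π = π} {ρ} {c} {d} eq = ≡.trans (≡.sym (ins-new π c)) (≡.trans (eq new) (ins-new ρ d))

ins-injective : ∀ {n} {π ρ : Permutation′ (suc n)} {c} → ins π c ≈ₚ ins ρ c → π ≈ₚ ρ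
ins-injective {π = π} {ρ} {c} eq i = punchIn-injective new _ _
  (≡.trans (≡.sym (insert-punchIn new new π i)) (≡.trans
    (≡.trans (≡.sym (inverseˡ (transpose new c))) (≡.trans (≡.cong (transpose new c ⟨$⟩ˡ_) (eq (old i)))
      (inverseˡ (transpose new c))))
    (insert-punchIn new new ρ i)))

insertions-unique : ∀ m → AllPairs (λ π ρ → ¬ (π ≈ₚ ρ)) (insertions m)
insertions-unique m = AllPairs.concat⁺
  (All.map⁺ (All.universal (λ σ → AllPairs.map⁺ (AllPairs.map
    (λ {c} {d} c≢d eq → c≢d (inject₁-injective (ins-target-injective {π = σ ⋆} {σ ⋆} eq))) (allFin⁺ _))) _))
  (AllPairs.map⁺ (AllPairs.map (λ {σ} {τ} → separate σ τ) (𝔖-distinct (suc m))))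
  where
  separate : ∀ σ τ → ¬ (σ ≈ₚ τ) →
    All (λ π → All (λ ρ → ¬ (π ≈ₚ ρ)) (insertionsInto τ)) (insertionsInto σ)
  separate σ τ σ≉τ = All.map⁺ (All.universal (λ c → All.map⁺ (All.universal (λ d eq →
    σ≉τ (⋆-injective {σ = σ} {τ} (ins-injective {π = σ ⋆} {τ ⋆} {inject₁ c}
      (≡.subst (λ d → ins (σ ⋆) (inject₁ c) ≈ₚ ins (τ ⋆) d)
        (≡.sym (ins-target-injective {π = σ ⋆} {τ ⋆} eq)) eq)))) _)) _)

⋆-zero-last : ∀ {m} → All FromZeroToLast (stars m)
⋆-zero-last = All.map⁺ (All.universal (λ σ → ⋆-zero σ) _)

-- A target of the form `inject₁ x` is never the last element, so the arc leaving 0 is not the one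
-- that is broken.
ins-zero-last : ∀ {m} (π : Permutation′ (2 ℕ.+ m)) x → FromZeroToLast π → FromZeroToLast (ins π (inject₁ x))
ins-zero-last π x 0↦last = ≡.trans
  (ins-miss π (inject₁ x) {zero} (λ eq → fromℕ≢inject₁ (≡.trans (≡.cong old (≡.sym 0↦last)) eq)))
  (≡.cong old 0↦last)

insertions-zero-last : ∀ m → All FromZeroToLast (insertions m)
insertions-zero-last m = All.concat⁺ (All.map⁺ {f = insertionsInto} (All.universal (λ σ → All.map⁺
  (All.universal (λ x → ins-zero-last (σ ⋆) x (⋆-zero σ)) (allFin (2 ℕ.+ m)))) (𝔖 (suc m))))

-- The image of `new` is an admissible target, because the last element is already the image of 0;
-- the permutation inserted into is recovered by closing `new` into a loop and deleting it.
insertions-complete : ∀ {m} (π : Permutation′ (3 ℕ.+ m)) → FromZeroToLast π → Any (π ≈ₚ_) (insertions m)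
insertions-complete {m} π 0↦last = go (π ⟨$⟩ʳ new) ≡.refl
  where
  go : ∀ c → π ⟨$⟩ʳ new ≡ c → Any (π ≈ₚ_) (insertions m)
  go c new↦c with view c
  ... | ‵fromℕ = contradiction
    (≡.trans (≡.sym (inverseˡ π)) (≡.trans (≡.cong (π ⟨$⟩ˡ_) (≡.trans new↦c (≡.sym 0↦last))) (inverseˡ π))) λ ()
  ... | ‵inject₁ x = Any.concatMap⁺ insertionsInto
    (Any.map (λ {σ} ρ≈σ⋆ → Any.map⁺ (Any.map (λ { ≡.refl → π≈ins σ ρ≈σ⋆ }) (∈-allFin x)))
      (Any.map⁻ (stars-complete ρ 0↦last′)))
    where
    c′ = inject₁ x
    -- Undoes the transposition in `ins`: exchanging the values `c′` and `new` makes `new` a fixed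
    -- point.
    β = π ∘ₚ transpose c′ new
    ρ = remove new β

    new↦new : β ⟨$⟩ʳ new ≡ new
    new↦new = ≡.trans (≡.cong (Components.transpose c′ new) new↦c) (transpose-left c′ new)

    β-old : ∀ z → β ⟨$⟩ʳ old z ≡ old (ρ ⟨$⟩ʳ z)
    β-old z = ≡.trans (punchIn-permute β new z) (≡.cong (λ y → punchIn y (ρ ⟨$⟩ʳ z)) new↦new)

    0↦last′ : FromZeroToLast ρ
    0↦last′ = punchIn-injective new _ _ (≡.trans (≡.sym (β-old zero))
      (≡.trans (≡.cong (Components.transpose c′ new) 0↦last)
        (transpose-other {i = c′} {new} {old (fromℕ (suc m))} fromℕ≢inject₁ λ ())))

    π≈ins : ∀ σ → ρ ≈ₚ σ ⋆ → π ≈ₚ ins (σ ⋆) c′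
    π≈ins σ ρ≈ i = ≡.trans (≡.sym (inverseˡ (transpose c′ new))) (≡.cong (Components.transpose new c′) (β≈ i))
      where
      β≈ : β ≈ₚ insert new new (σ ⋆)
      β≈ i with oldOrNew i
      ... | isNew   = new↦new
      ... | isOld z = ≡.trans (β-old z) (≡.trans (≡.cong old (ρ≈ z)) (≡.sym (insert-punchIn new new (σ ⋆) z)))

stars↭insertions : ∀ m → let open SetoidPermutation (permutations (3 ℕ.+ m)) in stars (2 ℕ.+ m) ↭ insertions m
stars↭insertions m = unique⇒↭ (permutations (3 ℕ.+ m)) (stars-unique (2 ℕ.+ m)) (insertions-unique m)
  (λ {π} π∈ → insertions-complete π (zero-last {π = π} ⋆-zero-last π∈))
  (λ {π} π∈ → stars-complete π (zero-last {π = π} (insertions-zero-last m) π∈))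
  where
  zero-last : ∀ {n πs} {π : Permutation′ (suc n)} → All FromZeroToLast πs → Any (π ≈ₚ_) πs → FromZeroToLast π
  zero-last all π∈ with 0↦last , π≈ ← All.lookupAny all π∈ = ≡.trans (π≈ zero) 0↦last

module Sums {c ℓ} (R : CommutativeRing c ℓ) where

  open CommutativeRing R hiding (zero)
  open GeneratingFunctions R hiding (A)

  ∑-cong : ∀ {S : Set} (xs : List S) {f g : S → Carrier} → (∀ x → f x ≈ g x) → ∑ xs f ≈ ∑ xs g
  ∑-cong []       eq = refl
  ∑-cong (x ∷ xs) eq = +-cong (eq x) (∑-cong xs eq)

  ∑-map : ∀ {S S′ : Set} (g : S → S′) xs (f : S′ → Carrier) → ∑ (map g xs) f ≡ ∑ xs (f ∘ g)
  ∑-map g []       f = ≡.refl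
  ∑-map g (x ∷ xs) f = ≡.cong (f (g x) +_) (∑-map g xs f)

  ∑-++ : ∀ {S : Set} xs ys (f : S → Carrier) → ∑ (xs ++ ys) f ≈ ∑ xs f + ∑ ys f
  ∑-++ []       ys f = sym (+-identityˡ _)
  ∑-++ (x ∷ xs) ys f = trans (+-congˡ (∑-++ xs ys f)) (sym (+-assoc _ _ _))

  ∑-concatMap : ∀ {S S′ : Set} (g : S → List S′) xs (f : S′ → Carrier) →
    ∑ (concatMap g xs) f ≈ ∑ xs (λ x → ∑ (g x) f)
  ∑-concatMap g []       f = refl
  ∑-concatMap g (x ∷ xs) f = trans (∑-++ (g x) _ f) (+-congˡ (∑-concatMap g xs f))

  ∑-stars : ∀ m (f : Permutation′ (3 ℕ.+ m) → Carrier) → (∀ {π ρ} → π ≈ₚ ρ → f π ≈ f ρ) →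
    ∑ (𝔖 (2 ℕ.+ m)) (λ σ → f (σ ⋆)) ≈
    ∑ (𝔖 (suc m)) (λ σ → ∑ (allFin (2 ℕ.+ m)) (λ x → f (ins (σ ⋆) (inject₁ x))))
  ∑-stars m f f-cong = begin
    ∑ (𝔖 (2 ℕ.+ m)) (λ σ → f (σ ⋆)) ≡⟨ ∑-map _⋆ (𝔖 (2 ℕ.+ m)) f ⟨
    ∑ (stars (2 ℕ.+ m)) f
      ≈⟨ Permutation.foldr-commMonoid setoid +-isCommutativeMonoid
           (Permutation.map⁺ (permutations (3 ℕ.+ m)) setoid f-cong (stars↭insertions m)) ⟩
    ∑ (insertions m) f ≈⟨ ∑-concatMap insertionsInto (𝔖 (suc m)) f ⟩
    ∑ (𝔖 (suc m)) (λ σ → ∑ (insertionsInto σ) f)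
      ≈⟨ ∑-cong (𝔖 (suc m)) (λ σ → reflexive (∑-map (λ x → ins (σ ⋆) (inject₁ x)) (allFin (2 ℕ.+ m)) f)) ⟩
    ∑ (𝔖 (suc m)) (λ σ → ∑ (allFin (2 ℕ.+ m)) (λ x → f (ins (σ ⋆) (inject₁ x)))) ∎
    where open SetoidReasoning setoid

-- The statistics as letter counts

open MonoidSum ℕ.+-0-commutativeMonoid using ()
  renaming (sum to sumℕ; sum-cong-≗ to sumℕ-cong; ∑-distrib-+ to sumℕ-+; sum-init-last to sumℕ-init-last)

ι : Bool → ℕ
ι b = if b then 1 else 0

#≡sum : ∀ {n} {P : Pred (Fin n) 0ℓ} (P? : Decidable₁ P) → # P? ≡ sumℕ (λ i → ι (does (P? i)))
#≡sum P? = go P? id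
  where
  go : ∀ {n} {A : Set} {P : Pred A 0ℓ} (P? : Decidable₁ P) (g : Fin n → A) →
    length (filter P? (List.tabulate g)) ≡ sumℕ (λ i → ι (does (P? (g i))))
  go {zero}  P? g = ≡.refl
  go {suc n} P? g with does (P? (g zero))
  ... | true  = ≡.cong suc (go P? (g ∘ suc))
  ... | false = go P? (g ∘ suc)

#-inner : ∀ {m} {P : Pred (Fin (2 ℕ.+ m)) 0ℓ} (P? : Decidable₁ P) →
  # (λ i → inner? i ×-dec P? i) ≡ sumℕ (λ i → ι (does (P? (inner i))))
#-inner {m} P? = begin
  # (λ i → inner? i ×-dec P? i)        ≡⟨ #≡sum (λ i → inner? i ×-dec P? i) ⟩
  -- The element 0 fails `inner?` by computation and has already vanished; the last element is split
  -- off to vanish by `F-last`.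
  sumℕ (F ∘ suc)                        ≡⟨ sumℕ-init-last (F ∘ suc) ⟩
  sumℕ (F ∘ inner) ℕ.+ F (fromℕ (suc m)) ≡⟨ ≡.cong₂ ℕ._+_ (sumℕ-cong F-inner) F-last ⟩
  sumℕ (λ i → ι (does (P? (inner i)))) ℕ.+ 0 ≡⟨ ℕ.+-identityʳ _ ⟩
  sumℕ (λ i → ι (does (P? (inner i))))  ∎
  where
  open ≡-Reasoning
  F : Fin (2 ℕ.+ m) → ℕ
  F i = ι (does (inner? i ×-dec P? i))
  F-last : F (fromℕ (suc m)) ≡ 0
  F-last rewrite Fin.toℕ-fromℕ m | dec-false (m ℕ.<? m) (ℕ.<-irrefl ≡.refl) = ≡.refl
  F-inner : ∀ i → F (inner i) ≡ ι (does (P? (inner i)))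
  F-inner i = ≡.cong (λ b → ι (b ∧ does (P? (inner i)))) (dec-true (toℕ (inner i) ℕ.<? suc m)
    (ℕ.s<s (Fin.inject₁ℕ< i)))

tally-tabulate : ∀ {m} k (u : Fin m → Letter) → tally k (tabulate u) ≡ sumℕ (k ∘ u)
tally-tabulate {zero}  k u = ≡.refl
tally-tabulate {suc m} k u = ≡.cong (k (u zero) ℕ.+_) (tally-tabulate k (u ∘ suc))

-- exc counts the arcs going up by their sources, isRise by their targets; this
-- leaves weight 1 to valleys.
isPeak isRise : Letter → ℕ
isPeak fixed      = 0
isPeak (arcs i o) = ι (i ∧ not o)
isRise fixed      = 1
isRise (arcs i o) = ι i

module _ {n : ℕ} (π : Permutation′ n) where

  letter-isFixed : ∀ x → ι ((π ⟨$⟩ʳ x) ≡ᵇ x) ≡ isFixed (letter π x)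
  letter-isFixed x with (π ⟨$⟩ʳ x) ≡ᵇ x
  ... | true  = ≡.refl
  ... | false = ≡.refl

  letter-isPeak : ∀ x → ι (((π ⟨$⟩ˡ x) <ᵇ x) ∧ ((π ⟨$⟩ʳ x) <ᵇ x)) ≡ isPeak (letter π x)
  letter-isPeak x with Fin.<-cmp (π ⟨$⟩ʳ x) x
  ... | tri≈ _ eq _ rewrite letter-fixed π eq | eq | <ᵇ-irrefl x = ≡.cong ι (∧-zeroʳ _)
  ... | tri< s<x s≢x s≯x rewrite letter-arcs π s≢x
      | dec-true ((π ⟨$⟩ʳ x) Fin.<? x) s<x | dec-false (x Fin.<? (π ⟨$⟩ʳ x)) s≯x = ≡.refl
  ... | tri> s≮x s≢x s>x rewrite letter-arcs π s≢x
      | dec-false ((π ⟨$⟩ʳ x) Fin.<? x) s≮x | dec-true (x Fin.<? (π ⟨$⟩ʳ x)) s>x = ≡.refl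

  letter-isRise : ∀ x → ι ((π ⟨$⟩ʳ x) ≡ᵇ x) ℕ.+ ι ((π ⟨$⟩ˡ x) <ᵇ x) ≡ isRise (letter π x)
  letter-isRise x with (π ⟨$⟩ʳ x) ≟ x
  ... | yes eq rewrite ⟨$⟩ˡ-unique π eq | <ᵇ-irrefl x = ≡.refl
  ... | no neq = ≡.refl

-- Since σ⋆ lowers values by one, an excedance of σ is a weak one of σ⋆: either a fixed point or a
-- strict rise.
inject₁-rise : ∀ {n} (a b : Fin n) → ι (a <ᵇ b) ≡ ι (inject₁ b ≡ᵇ suc a) ℕ.+ ι (suc a <ᵇ inject₁ b)
inject₁-rise a       zero          = ≡.refl
inject₁-rise zero    (suc zero)    = ≡.refl
inject₁-rise zero    (suc (suc b)) = ≡.refl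
inject₁-rise (suc a) (suc b)       = inject₁-rise a b

module _ {m : ℕ} (σ : Permutation′ (suc m)) where
  private
    π = σ ⋆

  fix*≡fixes : fix* σ ≡ fixes (word π)
  fix*≡fixes = ≡.trans (#-inner (λ i → (π ⟨$⟩ʳ i) ≟ i))
    (≡.trans (sumℕ-cong (λ i → letter-isFixed π (inner i))) (≡.sym (tally-tabulate isFixed (letter π ∘ inner))))

  cpk*≡tally : cpk* σ ≡ tally isPeak (word π)
  cpk*≡tally = ≡.trans (#-inner (λ i → ((π ⟨$⟩ˡ i) Fin.<? i) ×-dec ((π ⟨$⟩ʳ i) Fin.<? i)))
    (≡.trans (sumℕ-cong (λ i → letter-isPeak π (inner i))) (≡.sym (tally-tabulate isPeak (letter π ∘ inner))))

  exc≡tally : exc σ ≡ tally isRise (word π)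
  exc≡tally = begin
    exc σ ≡⟨ #≡sum (λ i → i Fin.<? (σ ⟨$⟩ʳ i)) ⟩
    sumℕ E ≡⟨ sumℕ-init-last E ⟩
    sumℕ (E ∘ inject₁) ℕ.+ E (fromℕ m) ≡⟨ ≡.cong (sumℕ (E ∘ inject₁) ℕ.+_) E-last ⟩
    sumℕ (E ∘ inject₁) ℕ.+ 0 ≡⟨ ℕ.+-identityʳ _ ⟩
    sumℕ (E ∘ inject₁) ≡⟨ sumℕ-cong E-inner ⟩
    sumℕ (λ i → loop i ℕ.+ ι (inner i <ᵇ (π ⟨$⟩ʳ inner i))) ≡⟨ sumℕ-+ loop _ ⟩
    sumℕ loop ℕ.+ sumℕ (λ i → ι (inner i <ᵇ (π ⟨$⟩ʳ inner i)))
      -- With the constant function 1, `sum-up` counts up arcs by sources and by targets;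
      -- `suc-injective` discards the arc 0 → n counted on both sides.
      ≡⟨ ≡.cong (sumℕ loop ℕ.+_) (ℕ.suc-injective (sum-up ℕ.+-0-commutativeMonoid π (⋆-zero σ) (λ _ → 1))) ⟩
    sumℕ loop ℕ.+ sumℕ (λ i → ι ((π ⟨$⟩ˡ inner i) <ᵇ inner i)) ≡⟨ sumℕ-+ loop _ ⟨
    sumℕ (λ i → loop i ℕ.+ ι ((π ⟨$⟩ˡ inner i) <ᵇ inner i)) ≡⟨ sumℕ-cong (λ i → letter-isRise π (inner i)) ⟩
    sumℕ (isRise ∘ letter π ∘ inner) ≡⟨ tally-tabulate isRise (letter π ∘ inner) ⟨
    tally isRise (word π) ∎
    where
    open ≡-Reasoning
    E : Fin (suc m) → ℕ
    E i = ι (i <ᵇ (σ ⟨$⟩ʳ i))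
    loop : Fin m → ℕ
    loop i = ι ((π ⟨$⟩ʳ inner i) ≡ᵇ inner i)
    E-last : E (fromℕ m) ≡ 0
    E-last = ≡.cong ι (dec-false (fromℕ m Fin.<? (σ ⟨$⟩ʳ fromℕ m)) (ℕ.≤⇒≯ (Fin.≤fromℕ (σ ⟨$⟩ʳ fromℕ m))))
    E-inner : ∀ i → E (inject₁ i) ≡ loop i ℕ.+ ι (inner i <ᵇ (π ⟨$⟩ʳ inner i))
    E-inner i = ≡.trans (inject₁-rise (inject₁ i) (σ ⟨$⟩ʳ inject₁ i))
      (≡.cong (λ s → ι (s ≡ᵇ inner i) ℕ.+ ι (inner i <ᵇ s)) (≡.sym (⋆-suc σ (inject₁ i))))

  fixes≤cyc# : fixes (word π) ≤ cyc# π
  fixes≤cyc# = ≡.subst₂ _≤_ fix*≡fixes (≡.sym (cyc#≡cyc π)) (fix*≤cyc* σ)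

  cyc*-fix*≡ : cyc*-fix* σ ≡ cyc# π ∸ fixes (word π)
  cyc*-fix*≡ = ≡.cong₂ _∸_ (≡.sym (cyc#≡cyc π)) fix*≡fixes

-- Substitutions

-- The pair (a , b) is the integer a - b.  Results are cancelled, so that the
-- solver sees equal coefficients of two normal forms as identical.
cancelled : ℕ × ℕ → ℕ × ℕ
cancelled (a , b) = a ∸ b , b ∸ a

differences : RawRing _ _
differences = record
  { Carrier = ℕ × ℕ
  ; _≈_ = _≡_
  ; _+_ = λ (a , b) (c , d) → cancelled (a ℕ.+ c , b ℕ.+ d)
  ; _*_ = λ (a , b) (c , d) → cancelled (a ℕ.* c ℕ.+ b ℕ.* d , a ℕ.* d ℕ.+ b ℕ.* c)
  ; -_ = λ (a , b) → b , a
  ; 0# = 0 , 0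
  ; 1# = 1 , 0
  }

module RationalIdentities {c ℓ} (R : CommutativeRing c ℓ) where

  open CommutativeRing R hiding (zero)
  open GeneratingFunctions R hiding (A)
  open Mult semiring using (×-homo-+; ×1-homo-*; ×-congˡ)
  open SetoidReasoning setoid

  open AbelianGroupProperties +-abelianGroup using (⁻¹-∙-comm; ⁻¹-involutive)
  open RingProperties ring using (-‿distribˡ-*; -‿distribʳ-*; -0#≈0#)
  open SemigroupProperties +-commutativeSemigroup using (interchange)

  ⟦_⟧ᵈ : ℕ × ℕ → Carrier
  ⟦ a , b ⟧ᵈ = a · 1# - b · 1#

  neg*neg : ∀ x y → - x * - y ≈ x * y
  neg*neg x y = trans (sym (-‿distribˡ-* x (- y)))
    (trans (-‿cong (sym (-‿distribʳ-* x y))) (⁻¹-involutive (x * y)))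

  +-minus : ∀ a b c d → (a + c) - (b + d) ≈ (a - b) + (c - d)
  +-minus a b c d = trans (+-congˡ (sym (⁻¹-∙-comm b d))) (interchange a c (- b) (- d))

  *-minus : ∀ a b c d → (a * c + b * d) - (a * d + b * c) ≈ (a - b) * (c - d)
  *-minus a b c d = sym (begin
    (a - b) * (c - d) ≈⟨ distribˡ _ _ _ ⟩
    (a - b) * c + (a - b) * - d ≈⟨ +-cong (distribʳ _ _ _) (distribʳ _ _ _) ⟩
    (a * c + - b * c) + (a * - d + - b * - d)
      ≈⟨ +-cong (+-congˡ (sym (-‿distribˡ-* b c))) (+-cong (sym (-‿distribʳ-* a d)) (neg*neg b d)) ⟩
    (a * c - b * c) + (- (a * d) + b * d) ≈⟨ +-congˡ (+-comm _ _) ⟩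
    (a * c - b * c) + (b * d - a * d) ≈⟨ interchange _ _ _ _ ⟩
    (a * c + b * d) + (- (b * c) - a * d) ≈⟨ +-congˡ (+-comm _ _) ⟩
    (a * c + b * d) + (- (a * d) - b * c) ≈⟨ +-congˡ (⁻¹-∙-comm _ _) ⟩
    (a * c + b * d) - (a * d + b * c) ∎)

  ᵈ-cong : ∀ a b c d → a ℕ.+ d ≡ c ℕ.+ b → ⟦ a , b ⟧ᵈ ≈ ⟦ c , d ⟧ᵈ
  ᵈ-cong a b c d eq = begin
    A - B               ≈⟨ +-congʳ (+-identityʳ A) ⟨
    (A + 0#) - B        ≈⟨ +-congʳ (+-congˡ (-‿inverseʳ D)) ⟨
    (A + (D - D)) - B   ≈⟨ +-congʳ (+-assoc _ _ _) ⟨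
    ((A + D) - D) - B   ≈⟨ +-congʳ (+-congʳ A+D≈C+B) ⟩
    ((C + B) - D) - B   ≈⟨ +-assoc _ _ _ ⟩
    (C + B) + (- D - B) ≈⟨ interchange _ _ _ _ ⟩
    (C - D) + (B - B)   ≈⟨ +-congˡ (-‿inverseʳ B) ⟩
    (C - D) + 0#        ≈⟨ +-identityʳ _ ⟩
    C - D               ∎
    where
    A = a · 1#
    B = b · 1#
    C = c · 1#
    D = d · 1#
    A+D≈C+B : A + D ≈ C + B
    A+D≈C+B = trans (sym (×-homo-+ 1# a d)) (trans (×-congˡ eq) (×-homo-+ 1# c b))

  cancelled≈ : ∀ p → ⟦ cancelled p ⟧ᵈ ≈ ⟦ p ⟧ᵈ
  cancelled≈ (a , b) = ᵈ-cong (a ∸ b) (b ∸ a) a b (balance a b)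
    where
    balance : ∀ a b → (a ∸ b) ℕ.+ b ≡ a ℕ.+ (b ∸ a)
    balance zero    zero    = ≡.refl
    balance zero    (suc b) = ≡.refl
    balance (suc a) zero    = ≡.refl
    balance (suc a) (suc b) = ≡.trans (ℕ.+-suc (a ∸ b) b) (≡.cong suc (balance a b))

  -- The solver needs its constants 0 and 1 to denote 0# and 1# on the nose.
  ⟦_⟧ᶜ : ℕ × ℕ → Carrier
  ⟦ 0 , 0 ⟧ᶜ = 0#
  ⟦ 1 , 0 ⟧ᶜ = 1#
  ⟦ p     ⟧ᶜ = ⟦ p ⟧ᵈ

  ᶜ≈ᵈ : ∀ p → ⟦ p ⟧ᶜ ≈ ⟦ p ⟧ᵈ
  ᶜ≈ᵈ (0 , 0)           = sym (-‿inverseʳ 0#)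
  ᶜ≈ᵈ (0 , suc _)       = refl
  ᶜ≈ᵈ (1 , 0)           = sym (trans (+-cong (+-identityʳ 1#) -0#≈0#) (+-identityʳ 1#))
  ᶜ≈ᵈ (1 , suc _)       = refl
  ᶜ≈ᵈ (suc (suc _) , 0)     = refl
  ᶜ≈ᵈ (suc (suc _) , suc _) = refl

  morphism : differences -Raw-AlmostCommutative⟶ fromCommutativeRing R
  morphism = record
    { ⟦_⟧ = ⟦_⟧ᶜ
    ; +-homo = λ p@(a , b) q@(c , d) → via (p +ᵈ q) (+-cong (ᶜ≈ᵈ p) (ᶜ≈ᵈ q)) (trans (cancelled≈ (a ℕ.+ c , b ℕ.+ d)) (trans
        (+-cong (×-homo-+ 1# a c) (-‿cong (×-homo-+ 1# b d)))
        (+-minus _ _ _ _)))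
    ; *-homo = λ p@(a , b) q@(c , d) → via (p *ᵈ q) (*-cong (ᶜ≈ᵈ p) (ᶜ≈ᵈ q)) (trans (cancelled≈ (a ℕ.* c ℕ.+ b ℕ.* d , a ℕ.* d ℕ.+ b ℕ.* c)) (trans
        (+-cong (×-2homo a c b d) (-‿cong (×-2homo a d b c)))
        (*-minus _ _ _ _)))
    ; -‿homo = λ p@(a , b) → via (b , a) (-‿cong (ᶜ≈ᵈ p))
        (trans (trans (+-comm _ _) (+-congˡ (sym (⁻¹-involutive _)))) (⁻¹-∙-comm _ _))
    ; 0-homo = refl
    ; 1-homo = refl
    }
    where
    open RawRing differences using () renaming (_+_ to _+ᵈ_; _*_ to _*ᵈ_)

    via : ∀ p {x y} → x ≈ y → ⟦ p ⟧ᵈ ≈ y → ⟦ p ⟧ᶜ ≈ x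
    via p x≈y p≈y = trans (ᶜ≈ᵈ p) (trans p≈y (sym x≈y))

    ×-2homo : ∀ a c b d → (a ℕ.* c ℕ.+ b ℕ.* d) · 1# ≈ a · 1# * c · 1# + b · 1# * d · 1#
    ×-2homo a c b d = trans (×-homo-+ 1# (a ℕ.* c) (b ℕ.* d)) (+-cong (×1-homo-* a c) (×1-homo-* b d))

  _≟ᵈ_ : ∀ p q → Maybe (⟦ p ⟧ᶜ ≈ ⟦ q ⟧ᶜ)
  p@(a , b) ≟ᵈ q@(c , d) with a ℕ.+ d ℕ.≟ c ℕ.+ b
  ... | no  _  = nothing
  ... | yes eq = just (trans (ᶜ≈ᵈ p) (trans (ᵈ-cong a b c d eq) (sym (ᶜ≈ᵈ q))))

  module Solver = RingSolver differences (fromCommutativeRing R) morphism _≟ᵈ_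
  open Solver

  unit-cancelˡ : ∀ {a x y} → Unit a → a * x ≈ a * y → x ≈ y
  unit-cancelˡ {a} {x} {y} (e , e*a≈1 , _) ax≈ay = begin
    x           ≈⟨ *-identityˡ x ⟨
    1# * x      ≈⟨ *-congʳ e*a≈1 ⟨
    e * a * x   ≈⟨ *-assoc e a x ⟩
    e * (a * x) ≈⟨ *-congˡ ax≈ay ⟩
    e * (a * y) ≈⟨ *-assoc e a y ⟨
    e * a * y   ≈⟨ *-congʳ e*a≈1 ⟩
    1# * y      ≈⟨ *-identityˡ y ⟩
    y           ∎

  *-/ : ∀ a {b} (b⁻¹ : Unit b) → b * a / b [ b⁻¹ ] ≈ a
  *-/ a {b} (e , e*b≈1 , _) = begin
    b * (a * e) ≈⟨ solve 3 (λ a b e → b :* (a :* e) := e :* b :* a) refl a b e ⟩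
    e * b * a   ≈⟨ *-congʳ e*b≈1 ⟩
    1# * a      ≈⟨ *-identityˡ a ⟩
    a           ∎

  module _ (t x : Carrier) (d₁ : Unit (1# + x)) (d₂ : Unit ((x + t) * (1# + x * t))) (d₃ : Unit (1# + x * t)) where

    private
      c′ = (1# + x * t) / (1# + x) [ d₁ ]
      x′ = ((1# + x) ^ 2 * t) / ((x + t) * (1# + x * t)) [ d₂ ]
      t′ = (x + t) / (1# + x * t) [ d₃ ]

    -- Rests on the factorisation (1 + x t) + (x + t) = (1 + x)(1 + t).
    c[1+t′]≈1+t : c′ * (1# + t′) ≈ 1# + t
    c[1+t′]≈1+t = unit-cancelˡ d₁ (begin
      (1# + x) * (c′ * (1# + t′))         ≈⟨ *-assoc _ _ _ ⟨
      (1# + x) * c′ * (1# + t′)           ≈⟨ *-congʳ (*-/ (1# + x * t) d₁) ⟩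
      (1# + x * t) * (1# + t′)            ≈⟨ distribˡ _ _ _ ⟩
      (1# + x * t) * 1# + (1# + x * t) * t′ ≈⟨ +-congˡ (*-/ (x + t) d₃) ⟩
      (1# + x * t) * 1# + (x + t)
        ≈⟨ solve 2 (λ t x → (con (1 , 0) :+ x :* t) :* con (1 , 0) :+ (x :+ t)
                            := (con (1 , 0) :+ x) :* (con (1 , 0) :+ t)) refl t x ⟩
      (1# + x) * (1# + t)                 ∎)

    c[cx′t′]≈t : c′ * (c′ * (x′ * t′)) ≈ t
    c[cx′t′]≈t = begin
      c′ * (c′ * (x′ * t′))
        -- The inverses enter as free variables; each is regrouped with its own denominator, leaving
        -- four factors equal to 1.
        ≈⟨ solve 5 (λ t x e₁ e₂ e₃ →
             let c = (:1 :+ x :* t) :* e₁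
                 x′ = ((:1 :+ x) :* ((:1 :+ x) :* :1) :* t) :* e₂
                 t′ = (x :+ t) :* e₃
             in c :* (c :* (x′ :* t′)) :=
                ((:1 :+ x) :* e₁) :* (((:1 :+ x) :* e₁) :*
                  ((((x :+ t) :* (:1 :+ x :* t)) :* e₂) :* (((:1 :+ x :* t) :* e₃) :* t))))
             refl t x (proj₁ d₁) (proj₁ d₂) (proj₁ d₃) ⟩
      D₁ * (D₁ * (D₂ * (D₃ * t)))
        ≈⟨ trans (1*  d₁ _) (trans (1* d₁ _) (trans (1* d₂ _) (1* d₃ t))) ⟩
      t ∎
      where
      :1 : ∀ {n} → Polynomial n
      :1 = con (1 , 0)
      D₁ = (1# + x) * proj₁ d₁
      D₂ = ((x + t) * (1# + x * t)) * proj₁ d₂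
      D₃ = (1# + x * t) * proj₁ d₃
      1* : ∀ {a} (a⁻¹ : Unit a) b → a * proj₁ a⁻¹ * b ≈ b
      1* (_ , _ , eq) b = trans (*-congʳ eq) (*-identityˡ b)

  module _ (x t s : Carrier) (s²≈ : s ^ 2 ≈ (1# + t) ^ 2 - 4 · x * t)
    (d₁ : Unit (2 · (1# - x) * t)) (d₂ : Unit (2 · x * t)) where

    private
      u = (1# + t ^ 2 - 2 · x * t - (1# - t) * s) / (2 · (1# - x) * t) [ d₁ ]
      v = ((1# + t) ^ 2 - 2 · x * t - (1# + t) * s) / (2 · x * t) [ d₂ ]
      α = 2 · (1# - x) * t
      β = 2 · x * t
      -- Given the square of `s`, the numerators of 1 + u, 1 + v, 1 + u v and 2 v over `α`, `β`,
      -- `α * β` and `β` become X, (1 + t) w, X w and w². Both required relations are then monomial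
      -- in X and w. Neither X nor w is assumed to be a unit, so only `α` and `β` are ever
      -- cancelled.
      w = 1# + t - s
      X = s * (s - 1# + t)

      :1 : ∀ {n} → Polynomial n
      :1 = con (1 , 0)
      infixr 9 :2_ :4_
      infix 10 _:²
      :2_ _:² : ∀ {n} → Polynomial n → Polynomial n
      :2 p = p :+ (p :+ con (0 , 0))
      p :² = p :* (p :* :1)
      :4_ : ∀ {n} → Polynomial n → Polynomial n
      :4 p = p :+ (p :+ (p :+ (p :+ con (0 , 0))))
      :Δ : ∀ {n} → Polynomial n → Polynomial n → Polynomial n
      :Δ x t = (:1 :+ t) :² :- :4 x :* t

    private
      Δ = (1# + t) ^ 2 - 4 · x * t

    α[1+u]≈X : α * (1# + u) ≈ X
    α[1+u]≈X = begin
      α * (1# + u) ≈⟨ distribˡ _ _ _ ⟩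
      α * 1# + α * u ≈⟨ +-congˡ (*-/ _ d₁) ⟩
      α * 1# + (1# + t ^ 2 - 2 · x * t - (1# - t) * s)
        ≈⟨ solve 3 (λ x t s → (:2 (:1 :- x) :* t) :* :1 :+ (:1 :+ t :² :- :2 x :* t :- (:1 :- t) :* s)
              := :Δ x t :- (:1 :- t) :* s) refl x t s ⟩
      Δ - (1# - t) * s ≈⟨ +-congʳ s²≈ ⟨
      s ^ 2 - (1# - t) * s
        ≈⟨ solve 2 (λ t s → s :² :- (:1 :- t) :* s := s :* (s :- :1 :+ t)) refl t s ⟩
      X ∎

    β[1+v]≈[1+t]w : β * (1# + v) ≈ (1# + t) * w
    β[1+v]≈[1+t]w = begin
      β * (1# + v) ≈⟨ distribˡ _ _ _ ⟩
      β * 1# + β * v ≈⟨ +-congˡ (*-/ _ d₂) ⟩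
      β * 1# + ((1# + t) ^ 2 - 2 · x * t - (1# + t) * s)
        ≈⟨ solve 3 (λ x t s → (:2 x :* t) :* :1 :+ ((:1 :+ t) :² :- :2 x :* t :- (:1 :+ t) :* s)
              := (:1 :+ t) :* (:1 :+ t :- s)) refl x t s ⟩
      (1# + t) * w ∎

    αβ[1+uv]≈Xw : α * β * (1# + u * v) ≈ X * w
    αβ[1+uv]≈Xw = begin
      α * β * (1# + u * v)
        ≈⟨ solve 4 (λ α β u v → α :* β :* (:1 :+ u :* v) := α :* β :+ (α :* u) :* (β :* v)) refl α β u v ⟩
      α * β + (α * u) * (β * v) ≈⟨ +-congˡ (*-cong (*-/ _ d₁) (*-/ _ d₂)) ⟩
      α * β + (1# + t ^ 2 - 2 · x * t - (1# - t) * s) * ((1# + t) ^ 2 - 2 · x * t - (1# + t) * s)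
        -- The two sides agree only modulo Δ - s²; the factor 1 + t² - s is the quotient of their
        -- difference by it.
        ≈⟨ solve 3 (λ x t s → 
             (:2 (:1 :- x) :* t) :* (:2 x :* t)
               :+ (:1 :+ t :² :- :2 x :* t :- (:1 :- t) :* s) :* ((:1 :+ t) :² :- :2 x :* t :- (:1 :+ t) :* s)
             := s :* (s :- :1 :+ t) :* (:1 :+ t :- s) :+ (:Δ x t :- s :²) :* 
                (:1 :+ t :² :- s))
             refl x t s ⟩
      X * w + (Δ - s ^ 2) * (1# + t ^ 2 - s) ≈⟨ +-congˡ (*-congʳ (+-congˡ (-‿cong s²≈))) ⟩
      X * w + (Δ - Δ) * (1# + t ^ 2 - s)     ≈⟨ +-congˡ (*-congʳ (-‿inverseʳ Δ)) ⟩
      X * w + 0# * (1# + t ^ 2 - s)          ≈⟨ +-congˡ (zeroˡ _) ⟩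
      X * w + 0#                             ≈⟨ +-identityʳ _ ⟩
      X * w                                  ∎

    2βv≈w² : 2 · (β * v) ≈ w * w
    2βv≈w² = begin
      2 · (β * v) ≈⟨ +-cong (*-/ _ d₂) (+-congʳ (*-/ _ d₂)) ⟩
      2 · ((1# + t) ^ 2 - 2 · x * t - (1# + t) * s)
        ≈⟨ solve 3 (λ x t s → :2 ((:1 :+ t) :² :- :2 x :* t :- (:1 :+ t) :* s)
              := (:1 :+ t) :* (:1 :+ t) :+ :Δ x t :- :2 ((:1 :+ t) :* s)) refl x t s ⟩
      (1# + t) * (1# + t) + Δ - 2 · ((1# + t) * s) ≈⟨ +-congʳ (+-congˡ s²≈) ⟨
      (1# + t) * (1# + t) + s ^ 2 - 2 · ((1# + t) * s)
        ≈⟨ solve 2 (λ t s → (:1 :+ t) :* (:1 :+ t) :+ s :² :- :2 ((:1 :+ t) :* s)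
              := (:1 :+ t :- s) :* (:1 :+ t :- s)) refl t s ⟩
      w * w ∎

    private
      Unit-* : ∀ {a b} → Unit a → Unit b → Unit (a * b)
      Unit-* {a} {b} (a⁻¹ , a⁻¹a≈1 , _) (b⁻¹ , b⁻¹b≈1 , _) = a⁻¹ * b⁻¹ , ab≈1 , trans (*-comm _ _) ab≈1
        where
        ab≈1 : a⁻¹ * b⁻¹ * (a * b) ≈ 1#
        ab≈1 = begin
          a⁻¹ * b⁻¹ * (a * b)
            ≈⟨ solve 4 (λ a b c d → c :* d :* (a :* b) := (c :* a) :* (d :* b)) refl a b a⁻¹ b⁻¹ ⟩
          (a⁻¹ * a) * (b⁻¹ * b) ≈⟨ *-cong a⁻¹a≈1 b⁻¹b≈1 ⟩
          1# * 1#               ≈⟨ *-identityʳ 1# ⟩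
          1#                    ∎

    [1+u][1+v]≈[1+t][1+uv] : (1# + u) * (1# + v) ≈ (1# + t) * (1# + u * v)
    [1+u][1+v]≈[1+t][1+uv] = unit-cancelˡ (Unit-* d₁ d₂) (begin
      α * β * ((1# + u) * (1# + v))
        ≈⟨ solve 4 (λ a b c d → a :* b :* (c :* d) := (a :* c) :* (b :* d)) refl α β (1# + u) (1# + v) ⟩
      (α * (1# + u)) * (β * (1# + v)) ≈⟨ *-cong α[1+u]≈X β[1+v]≈[1+t]w ⟩
      X * ((1# + t) * w)
        ≈⟨ solve 3 (λ a b c → a :* (b :* c) := b :* (a :* c)) refl X (1# + t) w ⟩
      (1# + t) * (X * w)                  ≈⟨ *-congˡ αβ[1+uv]≈Xw ⟨
      (1# + t) * (α * β * (1# + u * v))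
        ≈⟨ solve 3 (λ a b c → a :* (b :* c) := b :* (a :* c)) refl (1# + t) (α * β) (1# + u * v) ⟩
      α * β * ((1# + t) * (1# + u * v))   ∎)

    [1+u]²v≈xt[1+uv]² : (1# + u) * ((1# + u) * v) ≈ x * t * ((1# + u * v) * (1# + u * v))
    [1+u]²v≈xt[1+uv]² = unit-cancelˡ (Unit-* d₁ d₂) (unit-cancelˡ (Unit-* d₁ d₂) (begin
      α * β * (α * β * ((1# + u) * ((1# + u) * v)))
        -- One of the two factors β is spent as 2 x t: its x t moves out in front, and its 2
        -- completes `2 · (β * v)`, which is the square of `w`.
        ≈⟨ solve 5 (λ α x t p v → let β = :2 x :* t in
             α :* β :* (α :* β :* (p :* (p :* v))) := x :* t :* ((α :* p) :* (α :* p) :* :2 (β :* v)))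
             refl α x t (1# + u) v ⟩
      x * t * ((α * (1# + u)) * (α * (1# + u)) * 2 · (β * v))
        ≈⟨ *-congˡ (*-cong (*-cong α[1+u]≈X α[1+u]≈X) 2βv≈w²) ⟩
      x * t * (X * X * (w * w))
        ≈⟨ solve 3 (λ p a b → p :* (a :* a :* (b :* b)) := p :* ((a :* b) :* (a :* b))) refl (x * t) X w ⟩
      x * t * ((X * w) * (X * w))
        ≈⟨ *-congˡ (*-cong αβ[1+uv]≈Xw αβ[1+uv]≈Xw) ⟨
      x * t * ((α * β * (1# + u * v)) * (α * β * (1# + u * v)))
        ≈⟨ solve 3 (λ p a b → p :* ((a :* b) :* (a :* b)) := a :* (a :* (p :* (b :* b))))
             refl (x * t) (α * β) (1# + u * v) ⟩
      α * β * (α * β * (x * t * ((1# + u * v) * (1# + u * v)))) ∎))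

    module _ (d₃ : Unit (1# + u * v)) where

      private
        c′ = (1# + u) / (1# + u * v) [ d₃ ]
        e  = proj₁ d₃
        D  = 1# + u * v

        cancel : ∀ a → a * D * e ≈ a
        cancel a = trans (*-assoc a D e) (trans (*-congˡ (proj₂ (proj₂ d₃))) (*-identityʳ a))

      c[1+v]≈1+t : c′ * (1# + v) ≈ 1# + t
      c[1+v]≈1+t = begin
        (1# + u) * e * (1# + v)
          ≈⟨ solve 3 (λ a b c → a :* b :* c := a :* c :* b) refl (1# + u) e (1# + v) ⟩
        (1# + u) * (1# + v) * e ≈⟨ *-congʳ [1+u][1+v]≈[1+t][1+uv] ⟩
        (1# + t) * D * e        ≈⟨ cancel _ ⟩
        1# + t                  ∎

      c[cv]≈xt : c′ * (c′ * v) ≈ x * t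
      c[cv]≈xt = begin
        (1# + u) * e * ((1# + u) * e * v)
          ≈⟨ solve 3 (λ a b c → a :* b :* (a :* b :* c) := a :* (a :* c) :* b :* b) refl (1# + u) e v ⟩
        (1# + u) * ((1# + u) * v) * e * e ≈⟨ *-congʳ (*-congʳ [1+u]²v≈xt[1+uv]²) ⟩
        x * t * (D * D) * e * e           ≈⟨ *-congʳ (*-congʳ (sym (*-assoc _ _ _))) ⟩
        x * t * D * D * e * e             ≈⟨ *-congʳ (cancel _) ⟩
        x * t * D * e                     ≈⟨ cancel _ ⟩
        x * t                             ∎

-- Both generating functions in terms of Γ

module Expansion {c ℓ} (R : CommutativeRing c ℓ) (q : CommutativeRing.Carrier R) where

  open CommutativeRing R hiding (zero)
  open GeneratingFunctions R
  open Words R q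
  open Step R q
  open Sums R
  open SetoidReasoning setoid
  open SemigroupProperties *-commutativeSemigroup using (interchange)

  -- Induction on the length of words with `G` varying: removing the smallest inner element trades
  -- `G` for `T G`.
  ∑-H : ∀ m (G : Functional Letter m) → ∑ (𝔖 (suc m)) (λ σ → H G (σ ⋆)) ≈ q * run m G
  ∑-H zero G = begin
    q ^ (cyc# σ⋆ ∸ 0) * G [] + 0# ≈⟨ +-identityʳ _ ⟩
    -- For n = 1 the only σ⋆ exchanges 0 and 1. Once unfolded, `cyc` computes to 1, which yields the
    -- overall factor q.
    q ^ cyc# σ⋆ * G []            ≡⟨ ≡.cong (λ k → q ^ k * G []) (cyc#≡cyc σ⋆) ⟩
    q * 1# * G []                 ≈⟨ *-congʳ (*-identityʳ q) ⟩
    q * G []                      ∎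
    where
    σ⋆ = insert Fin.zero Fin.zero Perm.id ⋆
  ∑-H (suc m) G = begin
    ∑ (𝔖 (2 ℕ.+ m)) (λ σ → H G (σ ⋆)) ≈⟨ ∑-stars m (H G) (λ {π} {ρ} → H-cong G {π} {ρ}) ⟩
    ∑ (𝔖 (suc m)) (λ σ → ∑ (allFin (2 ℕ.+ m)) (λ y → H G (ins (σ ⋆) (inject₁ y))))
      ≈⟨ ∑-cong (𝔖 (suc m)) (λ σ → ∑-ins (σ ⋆) (⋆-zero σ) (fixes≤cyc# σ) G) ⟩
    ∑ (𝔖 (suc m)) (λ σ → H (T G) (σ ⋆)) ≈⟨ ∑-H m (T G) ⟩
    q * run (suc m) G ∎

  module _ (x t : Carrier) where

    letterWeight-powers : ∀ l → letterWeight x t l ≈ x ^ isPeak l * t ^ isRise l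
    letterWeight-powers fixed   = sym (trans (*-identityˡ _) (*-identityʳ t))
    letterWeight-powers peak    = *-cong (sym (*-identityʳ x)) (sym (*-identityʳ t))
    letterWeight-powers ascent  = sym (trans (*-identityˡ _) (*-identityʳ t))
    letterWeight-powers valley  = sym (*-identityˡ 1#)
    letterWeight-powers descent = sym (*-identityˡ 1#)

    weight-powers : ∀ {m} (w : Vec Letter m) →
      weight (letterWeight x t) w ≈ x ^ tally isPeak w * t ^ tally isRise w
    weight-powers []      = sym (*-identityˡ 1#)
    weight-powers (l ∷ w) = begin
      letterWeight x t l * weight (letterWeight x t) w
        ≈⟨ *-cong (letterWeight-powers l) (weight-powers w) ⟩
      (x ^ isPeak l * t ^ isRise l) * (x ^ tally isPeak w * t ^ tally isRise w)
        ≈⟨ interchange _ _ _ _ ⟩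
      (x ^ isPeak l * x ^ tally isPeak w) * (t ^ isRise l * t ^ tally isRise w)
        ≈⟨ *-cong (Exp.^-homo-* semiring x (isPeak l) _) (Exp.^-homo-* semiring t (isRise l) _) ⟨
      x ^ tally isPeak (l ∷ w) * t ^ tally isRise (l ∷ w) ∎

  1^ : ∀ k → 1# ^ k ≈ 1#
  1^ zero    = refl
  1^ (suc k) = trans (*-identityˡ _) (1^ k)

  -- The statistics are variables here, so that they are not unfolded.
  module _ {n : ℕ} {f f′ g g′ h h′ : Permutation′ n → ℕ}
    (f≡ : ∀ σ → f σ ≡ f′ σ) (g≡ : ∀ σ → g σ ≡ g′ σ) (h≡ : ∀ σ → h σ ≡ h′ σ)
    (Ω : List (Permutation′ n)) where

    P-stats : ∀ x t → P (f ∷ g ∷ h ∷ []) Ω (q ∷ x ∷ t ∷ []) ≈ ∑ Ω (λ σ → q ^ f′ σ * (x ^ g′ σ * t ^ h′ σ))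
    P-stats x t = ∑-cong Ω λ σ → trans
      (*-congˡ (*-congˡ (*-identityʳ _)))
      (reflexive (≡.cong₂ (λ k z → q ^ k * z) (f≡ σ) (≡.cong₂ (λ k l → x ^ k * t ^ l) (g≡ σ) (h≡ σ))))

    -- Supplies the missing peak variable as a power of 1, so that `A` becomes the case x = 1 of the
    -- sum for `P`.
    A-stats : ∀ t → ∑ Ω (λ σ → q ^ f σ * t ^ h σ) ≈ ∑ Ω (λ σ → q ^ f′ σ * (1# ^ g′ σ * t ^ h′ σ))
    A-stats t = ∑-cong Ω λ σ → trans
      (reflexive (≡.cong₂ (λ k l → q ^ k * t ^ l) (f≡ σ) (h≡ σ)))
      (*-congˡ (sym (trans (*-congʳ (1^ (g′ σ))) (*-identityˡ _))))

  ∑-powers : ∀ m x t →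
    ∑ (𝔖 (suc m)) (λ σ → q ^ (cyc# (σ ⋆) ∸ fixes (word (σ ⋆)))
      * (x ^ tally isPeak (word (σ ⋆)) * t ^ tally isRise (word (σ ⋆)))) ≈ q * Γ m (1# + t) (x * t)
  ∑-powers m x t = begin
    _ ≈⟨ ∑-cong (𝔖 (suc m)) (λ σ → *-congˡ (sym (weight-powers x t (word (σ ⋆))))) ⟩
    ∑ (𝔖 (suc m)) (λ σ → H (weight (letterWeight x t)) (σ ⋆)) ≈⟨ ∑-H m (weight (letterWeight x t)) ⟩
    q * run m (weight (letterWeight x t)) ≈⟨ *-congˡ (run≈Γ m x t) ⟩
    q * Γ m (1# + t) (x * t) ∎

  P≈Γ : ∀ m x t → P (cyc*-fix* ∷ cpk* ∷ exc ∷ []) (𝔖 (suc m)) (q ∷ x ∷ t ∷ []) ≈ q * Γ m (1# + t) (x * t)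
  P≈Γ m x t = trans
    (P-stats {f = cyc*-fix*} {g = cpk*} {h = exc} cyc*-fix*≡ cpk*≡tally exc≡tally (𝔖 (suc m)) x t)
    (∑-powers m x t)

  A≈Γ : ∀ m t → A (suc m) q t ≈ q * Γ m (1# + t) t
  A≈Γ m t = trans
    (A-stats {f = cyc*-fix*} {g = cpk*} {h = exc} cyc*-fix*≡ cpk*≡tally exc≡tally (𝔖 (suc m)) t)
    (trans (∑-powers m 1# t) (*-congˡ (Γ-cong m refl (*-identityˡ t))))

theorem3p5 : ∀ {c ℓ} (R : CommutativeRing c ℓ) →
    let open CommutativeRing R
        open GeneratingFunctions R
    in
    ∀ (n : ℕ) → 1 ≤ n →
    (∀ (q t x : Carrier)
       (d₁ : Unit (1# + x))
       (d₂ : Unit ((x + t) * (1# + x * t)))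
       (d₃ : Unit (1# + x * t)) →
       A n q t ≈
         ((1# + x * t) / (1# + x) [ d₁ ]) ^ (n ∸ 1)
         * P (cyc*-fix* ∷ cpk* ∷ exc ∷ []) (𝔖 n)
             ( q
             ∷ (((1# + x) ^ 2 * t) / ((x + t) * (1# + x * t)) [ d₂ ])
             ∷ ((x + t) / (1# + x * t) [ d₃ ])
             ∷ []))
    ×
    (∀ (q x t s : Carrier) →
       s ^ 2 ≈ (1# + t) ^ 2 - 4 · x * t →
       ∀ (d₁ : Unit (2 · (1# - x) * t))
         (d₂ : Unit (2 · x * t)) →
       let u = (1# + t ^ 2 - 2 · x * t - (1# - t) * s) / (2 · (1# - x) * t) [ d₁ ]
           v = ((1# + t) ^ 2 - 2 · x * t - (1# + t) * s) / (2 · x * t) [ d₂ ]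
       in
       ∀ (d₃ : Unit (1# + u * v)) →
       P (cyc*-fix* ∷ cpk* ∷ exc ∷ []) (𝔖 n) (q ∷ x ∷ t ∷ []) ≈
         ((1# + u) / (1# + u * v) [ d₃ ]) ^ (n ∸ 1) * A n q v)
theorem3p5 R (suc m) _ = first , second
  where
  open CommutativeRing R
  open GeneratingFunctions R
  open RationalIdentities R
  open SemigroupProperties *-commutativeSemigroup using (x∙yz≈y∙xz)

  rescale : ∀ q {a s y s′ y′} → let open Words R q in
    a * s ≈ s′ → a * (a * y) ≈ y′ → q * Γ m s′ y′ ≈ a ^ m * (q * Γ m s y)
  rescale q eqs eqy = trans (*-congˡ (Γ-rescaled m (sym eqs) (sym eqy))) (x∙yz≈y∙xz _ _ _)
    where open Words R q

  first = λ q t x d₁ d₂ d₃ → let open Expansion R q in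
    trans (A≈Γ m t) (trans
      (rescale q (c[1+t′]≈1+t t x d₁ d₂ d₃) (c[cx′t′]≈t t x d₁ d₂ d₃))
      (*-congˡ (sym (P≈Γ m _ _))))

  second = λ q x t s s²≈ d₁ d₂ d₃ → let open Expansion R q in
    trans (P≈Γ m x t) (trans
      (rescale q (c[1+v]≈1+t x t s s²≈ d₁ d₂ d₃) (c[cv]≈xt x t s s²≈ d₁ d₂ d₃))
      (*-congˡ (sym (A≈Γ m _))))
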